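{- Let $T$ be a recursively axiomatizable extension of Robinson arithmetic $Q$, and let the $\Sigma_1$ formula $\varphi(v_0,v_1)$, the closed term $t$ and the number $n$ be those constructed from $T$ in the context. (i) If $T$ is consistent, then $T\not\vdash\neg\varphi(n,t)$. (ii) If $T$ is $\omega$-consistent, then $T\not\vdash\varphi(n,t)$.
   Context: **Language and basic notions.** Fix a standard first-order language of arithmetic (with equality, constant $0$, unary function symbol $s$, binary function symbols $+,\cdot$, order $\le$ primitive or defined; $x<y$ means $x\le y\wedge x\ne y$). Formulas, sentences and terms are those of this language; the variables $v_0,v_1,v_2,\dots$ each count as one primitive symbol, and apart from the variables there are only finitely many primitive symbols. Terms are written with infix $\cdot$ and parentheses. A theory is an arbitrary set of sentences. $Q$ is Robinson arithmetic, with axioms $s(x)\neq 0$; $s(x)=s(y)\to x=y$; $x\ne0\to\exists y\,(x=s(y))$; $x+0=x$; $x+s(y)=s(x+y)$; $x\cdot 0=0$; $x\cdot s(y)=x\cdot y+x$; $x\le y\leftrightarrow\exists z\,(z+x=y)$. An extension of $Q$ is a theory proving all axioms of $Q$. $\omega$ denotes the standard model (and the set of natural numbers); "true" and "definable" mean true and definable in $\omega$. For $i\in\omega$, $\underline{i}$ is the numeral $s\cdots s0$ ($i$ occurrences of $s$); $i$ is written for $\underline i$ inside formulas. Fix a standard Gödel numbering; $\ulcorner\mu\urcorner$ is the Gödel number of $\mu$. A theory is recursively axiomatizable if it has the same theorems as some theory whose set of Gödel numbers is recursive. A formula is $\Sigma_1$ if it is of the form $(\exists v_i)\mu$ with $\mu$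 a $\Delta_0$ (bounded) formula. $T$ is $\omega$-consistent if for every formula $\eta(v_i)$, $T\vdash(\exists v_i)\eta(v_i)$ implies $T\not\vdash\neg\eta(j)$ for some number $j$ ($\omega$-consistency implies consistency). **Length and naming.** $|e|$ is the number of symbol occurrences in a term or formula $e$ (its length). A formula $\mu$ names the number $i$ if $\mu=\mu(v_0)$ has at most the free variable $v_0$ and $T\vdash(\forall v_0)(\mu(v_0)\leftrightarrow v_0=i)$. **The relation $\mathcal B$ and the formulas $\varphi,\psi$.** Fix a recursive function $g$ such that for every formula $\mu$ and number $j$: if all variables of $\mu$ are among the first $j$ variables $v_0,\dots,v_{j-1}$ and $|\mu|<j$, then $\ulcorner\mu\urcorner<g(j)$ (such a $g$ exists). Let $$\mathcal B=\{(i,j)\in\omega^2:\ \text{there is a formula }\mu\text{ with }\ulcorner\mu\urcorner<g(j),\ |\mu|<j,\text{ and }\mu\text{ names }i\}.$$ Since $T$ is recursively axiomatizable, $\mathcal B$ is recursively enumerable. Let $\varphi(v_0,v_1)$ be a $\Sigma_1$ formula with at most the free variables $v_0,v_1$ defining $\mathcal B$ (with bound variables such that the substitution below is free). Let $$\psi(v_0,v_1):=\neg\varphi(v_0,v_1)\wedge(\forall v_2<v_0)\,\varphi(v_2,v_1).$$ **The term $t$ and the number $n$.** Let $k_1=|\psi(v_0,v_1)|$, let $k_2$ be any natural number greater than the number of free occurrences of $v_1$ in $\psi(v_0,v_1)$, let $k=k_1k_2$, and let $t$ be the closed term $\underline{10}\cdot(\underline{k}\cdot\underline{k})$, with value $\mathbf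 t=10k^2$. If $T$ is a consistent extension of $Q$, only finitely many numbers can be named by formulas of length less than $\mathbf t$; $n$ is the least number that cannot be named by a formula of length less than $\mathbf t$. -}

module Defs where

open import Level using (0ℓ)
open import Data.Nat.Base using (ℕ; zero; suc; _+_; _*_; _^_; _≤_; _<_)
open import Data.Nat.Properties using (_≟_)
open import Data.Bool.Base using (if_then_else_)
open import Data.Fin.Base using (Fin)
open import Data.List.Base using (List; []; _∷_; _++_; [_]; length)
open import Data.List.Membership.Propositional using (_∈_; _∉_)
open import Data.List.Relation.Binary.Subset.Propositional using (_⊆_)
open import Data.List.Relation.Unary.All using (All)
open import Data.Vec.Base using (Vec; []; _∷_; lookup)
open import Data.Product.Base using (Σ; ∃; ∃-syntax; _×_; _,_)
open import Data.Sum.Base using (_⊎_)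
open import Data.Unit.Base using (⊤)
open import Function.Bundles using (_⇔_)
open import Relation.Binary.PropositionalEquality.Core using (_≡_)
open import Relation.Nullary.Decidable.Core using (does)
open import Relation.Nullary.Negation.Core using (¬_)
open import Relation.Unary using (Pred)

data Rec : ℕ → Set where
  zeroᴿ : Rec 0
  sucᴿ  : Rec 1
  proj  : ∀ {n} → Fin n → Rec n
  comp  : ∀ {m n} → Rec m → Vec (Rec n) m → Rec n
  prim  : ∀ {n} → Rec n → Rec (suc (suc n)) → Rec (suc n)
  min   : ∀ {n} → Rec (suc n) → Rec n

infix 4 _∙_⇓_

data _∙_⇓_ : ∀ {n} → Rec n → Vec ℕ n → ℕ → Set where
  ⇓zero  : zeroᴿ ∙ [] ⇓ 0
  ⇓suc   : ∀ {x} → sucᴿ ∙ x ∷ [] ⇓ suc x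
  ⇓proj  : ∀ {n} {i : Fin n} {xs} → proj i ∙ xs ⇓ lookup xs i
  ⇓comp  : ∀ {m n} {f : Rec m} {gs : Vec (Rec n) m} {xs ys z} →
           (∀ i → lookup gs i ∙ xs ⇓ lookup ys i) → f ∙ ys ⇓ z →
           comp f gs ∙ xs ⇓ z
  ⇓prim0 : ∀ {n} {f : Rec n} {h xs z} →
           f ∙ xs ⇓ z → prim f h ∙ 0 ∷ xs ⇓ z
  ⇓prim+ : ∀ {n} {f : Rec n} {h xs x y z} →
           prim f h ∙ x ∷ xs ⇓ y → h ∙ x ∷ y ∷ xs ⇓ z →
           prim f h ∙ suc x ∷ xs ⇓ z
  ⇓min   : ∀ {n} {f : Rec (suc n)} {xs y} →
           (∀ {z} → z < y → ∃[ w ] f ∙ z ∷ xs ⇓ suc w) →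
           f ∙ y ∷ xs ⇓ 0 →
           min f ∙ xs ⇓ y

Recursive : (ℕ → ℕ) → Set
Recursive f = ∃[ e ] (∀ x → e ∙ x ∷ [] ⇓ f x)

RecursiveSet : Pred ℕ 0ℓ → Set
RecursiveSet P = ∃[ χ ] Recursive χ ×
  (∀ x → (P x × χ x ≡ 1) ⊎ (¬ P x × χ x ≡ 0))

infix  9 _[_:=_] _[_:=_]ᵗ
infixl 8 _⊗_
infixl 7 _⊕_
infix  6 _≐_ _≼_ _≺_
infix  5 ~_
infixr 4 _∧_
infixr 3 _∨_
infixr 2 _⇒_
infix  1 _⟺_

data Term : Set where
  var     : ℕ → Term
  𝟎       : Term
  s       : Term → Term
  _⊕_ _⊗_ : Term → Term → Term

data Formula : Set where
  _≐_ _≼_     : Term → Term → Formula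
  ~_          : Formula → Formula
  _∧_ _∨_ _⇒_ : Formula → Formula → Formula
  all ex      : ℕ → Formula → Formula

_⟺_ : Formula → Formula → Formula
A ⟺ B = (A ⇒ B) ∧ (B ⇒ A)

_≺_ : Term → Term → Formula
a ≺ b = a ≼ b ∧ ~ (a ≐ b)

numeral : ℕ → Term
numeral zero    = 𝟎
numeral (suc i) = s (numeral i)

data Symbol : Set where
  ′v : ℕ → Symbol
  ′0 ′s ′+ ′· ′= ′≤ ′¬ ′∧ ′∨ ′→ ′∀ ′∃ ′⟨ ′⟩ : Symbol

symbolsᵗ : Term → List Symbol
symbolsᵗ (var x) = [ ′v x ]
symbolsᵗ 𝟎       = [ ′0 ]
symbolsᵗ (s a)   = ′s ∷ symbolsᵗ a
symbolsᵗ (a ⊕ b) = ′⟨ ∷ symbolsᵗ a ++ ′+ ∷ symbolsᵗ b ++ [ ′⟩ ]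
symbolsᵗ (a ⊗ b) = ′⟨ ∷ symbolsᵗ a ++ ′· ∷ symbolsᵗ b ++ [ ′⟩ ]

symbols : Formula → List Symbol
symbols (a ≐ b)   = symbolsᵗ a ++ ′= ∷ symbolsᵗ b
symbols (a ≼ b)   = symbolsᵗ a ++ ′≤ ∷ symbolsᵗ b
symbols (~ A)     = ′¬ ∷ symbols A
symbols (A ∧ B)   = ′⟨ ∷ symbols A ++ ′∧ ∷ symbols B ++ [ ′⟩ ]
symbols (A ∨ B)   = ′⟨ ∷ symbols A ++ ′∨ ∷ symbols B ++ [ ′⟩ ]
symbols (A ⇒ B)   = ′⟨ ∷ symbols A ++ ′→ ∷ symbols B ++ [ ′⟩ ]
symbols (all x A) = ′⟨ ∷ ′∀ ∷ ′v x ∷ ′⟩ ∷ symbols A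
symbols (ex x A)  = ′⟨ ∷ ′∃ ∷ ′v x ∷ ′⟩ ∷ symbols A

∣_∣ : Formula → ℕ
∣ A ∣ = length (symbols A)

symbolCode : Symbol → ℕ
symbolCode ′0     = 0
symbolCode ′s     = 1
symbolCode ′+     = 2
symbolCode ′·     = 3
symbolCode ′=     = 4
symbolCode ′≤     = 5
symbolCode ′¬     = 6
symbolCode ′∧     = 7
symbolCode ′∨     = 8
symbolCode ′→     = 9
symbolCode ′∀     = 10
symbolCode ′∃     = 11
symbolCode ′⟨     = 12
symbolCode ′⟩     = 13
symbolCode (′v x) = 14 + x

-- A bijection between strings and ℕ, iterating (m , n) ↦ 2ᵐ(2n + 1).
stringCode : List Symbol → ℕ
stringCode []       = 0
stringCode (c ∷ cs) = 2 ^ symbolCode c * (2 * stringCode cs + 1)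

⌜_⌝ : Formula → ℕ
⌜ A ⌝ = stringCode (symbols A)

occurrences : ℕ → Term → ℕ
occurrences x (var y) = if does (x ≟ y) then 1 else 0
occurrences x 𝟎       = 0
occurrences x (s a)   = occurrences x a
occurrences x (a ⊕ b) = occurrences x a + occurrences x b
occurrences x (a ⊗ b) = occurrences x a + occurrences x b

freeOccurrences : ℕ → Formula → ℕ
freeOccurrences x (a ≐ b)   = occurrences x a + occurrences x b
freeOccurrences x (a ≼ b)   = occurrences x a + occurrences x b
freeOccurrences x (~ A)     = freeOccurrences x A
freeOccurrences x (A ∧ B)   = freeOccurrences x A + freeOccurrences x B
freeOccurrences x (A ∨ B)   = freeOccurrences x A + freeOccurrences x B
freeOccurrences x (A ⇒ B)   = freeOccurrences x A + freeOccurrences x B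
freeOccurrences x (all y A) = if does (x ≟ y) then 0 else freeOccurrences x A
freeOccurrences x (ex y A)  = if does (x ≟ y) then 0 else freeOccurrences x A

NotIn : ℕ → Term → Set
NotIn x a = occurrences x a ≡ 0

NotFree : ℕ → Formula → Set
NotFree x A = freeOccurrences x A ≡ 0

FreeAmong : List ℕ → Formula → Set
FreeAmong xs A = ∀ x → x ∉ xs → NotFree x A

Sentence : Formula → Set
Sentence = FreeAmong []

_[_:=_]ᵗ : Term → ℕ → Term → Term
var y   [ x := a ]ᵗ = if does (x ≟ y) then a else var y
𝟎       [ x := a ]ᵗ = 𝟎
s b     [ x := a ]ᵗ = s (b [ x := a ]ᵗ)
(b ⊕ c) [ x := a ]ᵗ = b [ x := a ]ᵗ ⊕ c [ x := a ]ᵗ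
(b ⊗ c) [ x := a ]ᵗ = b [ x := a ]ᵗ ⊗ c [ x := a ]ᵗ

-- Bound variables are never renamed, so this is the intended substitution
-- only when a is free for x (see FreeFor); closed terms always are.
_[_:=_] : Formula → ℕ → Term → Formula
(b ≐ c)   [ x := a ] = b [ x := a ]ᵗ ≐ c [ x := a ]ᵗ
(b ≼ c)   [ x := a ] = b [ x := a ]ᵗ ≼ c [ x := a ]ᵗ
(~ A)     [ x := a ] = ~ (A [ x := a ])
(A ∧ B)   [ x := a ] = A [ x := a ] ∧ B [ x := a ]
(A ∨ B)   [ x := a ] = A [ x := a ] ∨ B [ x := a ]
(A ⇒ B)   [ x := a ] = A [ x := a ] ⇒ B [ x := a ]
(all y A) [ x := a ] = if does (x ≟ y) then all y A else all y (A [ x := a ])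
(ex y A)  [ x := a ] = if does (x ≟ y) then ex y A else ex y (A [ x := a ])

FreeFor : Term → ℕ → Formula → Set
FreeFor a x (b ≐ c)   = ⊤
FreeFor a x (b ≼ c)   = ⊤
FreeFor a x (~ A)     = FreeFor a x A
FreeFor a x (A ∧ B)   = FreeFor a x A × FreeFor a x B
FreeFor a x (A ∨ B)   = FreeFor a x A × FreeFor a x B
FreeFor a x (A ⇒ B)   = FreeFor a x A × FreeFor a x B
FreeFor a x (all y A) = NotFree x (all y A) ⊎ (NotIn y a × FreeFor a x A)
FreeFor a x (ex y A)  = NotFree x (ex y A) ⊎ (NotIn y a × FreeFor a x A)

record Theory : Set₁ where
  field
    Axiom  : Pred Formula 0ℓ
    closed : ∀ {A} → Axiom A → Sentence A

open Theory public

infix 0 _∣_⊢_ _⊢_ _⊬_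

data _∣_⊢_ (T : Theory) : List Formula → Formula → Set where
  ax   : ∀ {Γ A} → Axiom T A → T ∣ Γ ⊢ A
  hyp  : ∀ {Γ A} → A ∈ Γ → T ∣ Γ ⊢ A
  weak : ∀ {Γ Δ A} → Γ ⊆ Δ → T ∣ Γ ⊢ A → T ∣ Δ ⊢ A
  ¬I   : ∀ {Γ A B} → T ∣ A ∷ Γ ⊢ B → T ∣ A ∷ Γ ⊢ ~ B → T ∣ Γ ⊢ ~ A
  ¬¬E  : ∀ {Γ A} → T ∣ Γ ⊢ ~ ~ A → T ∣ Γ ⊢ A
  ∧I   : ∀ {Γ A B} → T ∣ Γ ⊢ A → T ∣ Γ ⊢ B → T ∣ Γ ⊢ A ∧ B
  ∧E₁  : ∀ {Γ A B} → T ∣ Γ ⊢ A ∧ B → T ∣ Γ ⊢ A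
  ∧E₂  : ∀ {Γ A B} → T ∣ Γ ⊢ A ∧ B → T ∣ Γ ⊢ B
  ∨I₁  : ∀ {Γ A B} → T ∣ Γ ⊢ A → T ∣ Γ ⊢ A ∨ B
  ∨I₂  : ∀ {Γ A B} → T ∣ Γ ⊢ B → T ∣ Γ ⊢ A ∨ B
  ∨E   : ∀ {Γ A B C} → T ∣ Γ ⊢ A ∨ B →
         T ∣ A ∷ Γ ⊢ C → T ∣ B ∷ Γ ⊢ C → T ∣ Γ ⊢ C
  ⇒I   : ∀ {Γ A B} → T ∣ A ∷ Γ ⊢ B → T ∣ Γ ⊢ A ⇒ B
  ⇒E   : ∀ {Γ A B} → T ∣ Γ ⊢ A ⇒ B → T ∣ Γ ⊢ A → T ∣ Γ ⊢ B
  ∀I   : ∀ {Γ x A} → All (NotFree x) Γ → T ∣ Γ ⊢ A → T ∣ Γ ⊢ all x A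
  ∀E   : ∀ {Γ x A} a → FreeFor a x A →
         T ∣ Γ ⊢ all x A → T ∣ Γ ⊢ A [ x := a ]
  ∃I   : ∀ {Γ x A} a → FreeFor a x A →
         T ∣ Γ ⊢ A [ x := a ] → T ∣ Γ ⊢ ex x A
  ∃E   : ∀ {Γ x A C} → All (NotFree x) Γ → NotFree x C →
         T ∣ Γ ⊢ ex x A → T ∣ A ∷ Γ ⊢ C → T ∣ Γ ⊢ C
  =I   : ∀ {Γ} a → T ∣ Γ ⊢ a ≐ a
  =E   : ∀ {Γ x a b} A → FreeFor a x A → FreeFor b x A →
         T ∣ Γ ⊢ a ≐ b → T ∣ Γ ⊢ A [ x := a ] → T ∣ Γ ⊢ A [ x := b ]

_⊢_ : Theory → Formula → Set
T ⊢ A = T ∣ [] ⊢ A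

_⊬_ : Theory → Formula → Set
T ⊬ A = ¬ (T ⊢ A)

Consistent : Theory → Set
Consistent T = ¬ (∃[ A ] (T ⊢ A) × (T ⊢ ~ A))

ω-Consistent : Theory → Set
ω-Consistent T = ∀ i η → FreeAmong [ i ] η →
  (T ⊢ ex i η) → ∃[ j ] (T ⊬ ~ η [ i := numeral j ])

RecursivelyAxiomatizable : Theory → Set₁
RecursivelyAxiomatizable T = Σ Theory λ T′ →
  (∀ A → (T ⊢ A) ⇔ (T′ ⊢ A)) ×
  RecursiveSet (λ m → ∃[ A ] Axiom T′ A × ⌜ A ⌝ ≡ m)

Q : List Formula
Q = all 0 (~ s x ≐ 𝟎)
  ∷ all 0 (all 1 (s x ≐ s y ⇒ x ≐ y))
  ∷ all 0 (~ x ≐ 𝟎 ⇒ ex 1 (x ≐ s y))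
  ∷ all 0 (x ⊕ 𝟎 ≐ x)
  ∷ all 0 (all 1 (x ⊕ s y ≐ s (x ⊕ y)))
  ∷ all 0 (x ⊗ 𝟎 ≐ 𝟎)
  ∷ all 0 (all 1 (x ⊗ s y ≐ x ⊗ y ⊕ x))
  ∷ all 0 (all 1 (x ≼ y ⟺ ex 2 (z ⊕ x ≐ y)))
  ∷ []
  where
  x = var 0
  y = var 1
  z = var 2

ExtendsQ : Theory → Set
ExtendsQ T = All (T ⊢_) Q

data Δ₀ : Formula → Set where
  eq   : ∀ {a b} → Δ₀ (a ≐ b)
  le   : ∀ {a b} → Δ₀ (a ≼ b)
  neg  : ∀ {A} → Δ₀ A → Δ₀ (~ A)
  and  : ∀ {A B} → Δ₀ A → Δ₀ B → Δ₀ (A ∧ B)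
  or   : ∀ {A B} → Δ₀ A → Δ₀ B → Δ₀ (A ∨ B)
  imp  : ∀ {A B} → Δ₀ A → Δ₀ B → Δ₀ (A ⇒ B)
  all≤ : ∀ {x a A} → NotIn x a → Δ₀ A → Δ₀ (all x (var x ≼ a ⇒ A))
  all< : ∀ {x a A} → NotIn x a → Δ₀ A → Δ₀ (all x (var x ≺ a ⇒ A))
  ex≤  : ∀ {x a A} → NotIn x a → Δ₀ A → Δ₀ (ex x (var x ≼ a ∧ A))
  ex<  : ∀ {x a A} → NotIn x a → Δ₀ A → Δ₀ (ex x (var x ≺ a ∧ A))

data Σ₁ : Formula → Set where
  ex : ∀ {A} x → Δ₀ A → Σ₁ (ex x A)

Assignment : Set
Assignment = ℕ → ℕ

_[_↦_] : Assignment → ℕ → ℕ → Assignment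
(ρ [ x ↦ m ]) y = if does (x ≟ y) then m else ρ y

⟦_⟧ : Term → Assignment → ℕ
⟦ var x ⟧ ρ = ρ x
⟦ 𝟎 ⟧     ρ = 0
⟦ s a ⟧   ρ = suc (⟦ a ⟧ ρ)
⟦ a ⊕ b ⟧ ρ = ⟦ a ⟧ ρ + ⟦ b ⟧ ρ
⟦ a ⊗ b ⟧ ρ = ⟦ a ⟧ ρ * ⟦ b ⟧ ρ

infix 0 ω,_⊨_

-- ¬, ∨, → and ∃ get their constructive meaning here.  For Δ₀ formulas, whose
-- truth is decidable, this agrees with classical truth; a Σ₁ formula holds
-- when an explicit witness satisfies its matrix.
ω,_⊨_ : Assignment → Formula → Set
ω, ρ ⊨ a ≐ b   = ⟦ a ⟧ ρ ≡ ⟦ b ⟧ ρ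
ω, ρ ⊨ a ≼ b   = ⟦ a ⟧ ρ ≤ ⟦ b ⟧ ρ
ω, ρ ⊨ ~ A     = ¬ (ω, ρ ⊨ A)
ω, ρ ⊨ A ∧ B   = (ω, ρ ⊨ A) × (ω, ρ ⊨ B)
ω, ρ ⊨ A ∨ B   = (ω, ρ ⊨ A) ⊎ (ω, ρ ⊨ B)
ω, ρ ⊨ A ⇒ B   = (ω, ρ ⊨ A) → (ω, ρ ⊨ B)
ω, ρ ⊨ all x A = ∀ m → ω, ρ [ x ↦ m ] ⊨ A
ω, ρ ⊨ ex x A  = ∃[ m ] (ω, ρ [ x ↦ m ] ⊨ A)

Defines : Formula → (ℕ → ℕ → Set) → Set
Defines A R = ∀ ρ → R (ρ 0) (ρ 1) ⇔ (ω, ρ ⊨ A)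

Names : Theory → Formula → ℕ → Set
Names T μ i = FreeAmong [ 0 ] μ × (T ⊢ all 0 (μ ⟺ var 0 ≐ numeral i))

NameableBelow : Theory → ℕ → Pred ℕ 0ℓ
NameableBelow T l i = ∃[ μ ] ∣ μ ∣ < l × Names T μ i

BoundsGödelNumbers : (ℕ → ℕ) → Set
BoundsGödelNumbers g = ∀ μ j →
  (∀ x → ′v x ∈ symbols μ → x < j) → ∣ μ ∣ < j → ⌜ μ ⌝ < g j

𝓑 : Theory → (ℕ → ℕ) → ℕ → ℕ → Set
𝓑 T g i j = ∃[ μ ] ⌜ μ ⌝ < g j × ∣ μ ∣ < j × Names T μ i

Ψ : Formula → Formula
Ψ φ = ~ φ ∧ all 2 (var 2 ≺ var 0 ⇒ φ [ 0 := var 2 ])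

tₖ : ℕ → Term
tₖ k = numeral 10 ⊗ (numeral k ⊗ numeral k)

Least : Pred ℕ 0ℓ → Pred ℕ 0ℓ
Least P n = P n × (∀ m → P m → n ≤ m)

{-# OPTIONS --safe #-}

-- If T ⊢ ¬φ(n,t), then ψ(v₀,t) names n: every m < n has a name shorter than 𝐭, so
-- φ(m,t) is a true Σ₁ sentence and hence provable, and Q proves that any v₀ is
-- comparable with n.  But ψ(v₀,t) is shorter than 𝐭, because substituting t into it
-- costs only about 2k symbols per occurrence of v₁ while 𝐭 = 10k²; so n has a short
-- name after all.  If T ⊢ φ(n,t), then ω-consistency makes some numerical instance
-- of the Δ₀ matrix irrefutable, although all of them are false and so refutable.
--
-- Short names must in addition have small Gödel numbers to be counted in 𝓑; this is
-- where bound variables have to be renamed to variables of small index.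

module Submission where

-- The argument is Berry's paradox counted in symbols: `φ(·,t)` is true of exactly the numbers with
-- a name shorter than 𝐭, and `ψ(v₀,t)` says that `v₀` is the least number without one. The term `t`
-- is a product because the numeral of 𝐭 would itself be longer than 𝐭. The factor `k` is the length
-- of `ψ` times a strict bound on the number of places where `t` enters, so it dominates both
-- quantities; the length of `ψ(v₀,t)` is then at most quadratic in `k`, with a coefficient below
-- 10. Comparability with `n` matters because a model of `T` may contain nonstandard elements: those
-- beyond `n` are excluded by the second conjunct of `ψ`, which would give `φ(n,t)`. Two obstacles
-- shape the proof. Truth in ω is constructive, so truth values must come out of decision
-- procedures, and a number below `n` is nameable only up to double negation. Substitution never
-- renames bound variables, so most syntactic lemmas carry conditions on variables.

open import Defs
open import Data.Bool.Base using (Bool; true; false; if_then_else_)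
open import Data.Fin.Base using (toℕ)
open import Data.Fin.Properties using (all?; pigeonhole; toℕ<n; ¬∀⟶∃¬)
open import Data.List.Base using (List; []; _∷_; _++_; [_]; filter; length; lookup; map)
open import Data.List.Membership.Propositional using (_∈_; _∉_)
open import Data.List.Membership.Propositional.Properties
  using (∈-++⁺ˡ; ∈-++⁺ʳ; ∈-filter⁺; ∈-map⁺; ∈-map⁻)
open import Data.List.Properties using (length-++; length-map; map-++; map-cong-local)
open import Data.List.Relation.Binary.Subset.Propositional using (_⊆_)
open import Data.List.Relation.Binary.Subset.Propositional.Properties using (filter-⊆; map⁺)
open import Data.List.Relation.Unary.All as All using (All; []; _∷_)
import Data.List.Relation.Unary.All.Properties as All
open import Data.List.Relation.Unary.Any using (here; there; index)
open import Data.List.Relation.Unary.Any.Properties using (lookup-index)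
open import Data.Nat.Base
open import Data.Nat.Properties
open import Data.List.Membership.DecPropositional _≟_ using (_∈?_)
open import Data.Nat.Solver using (module +-*-Solver)
open import Data.Product.Base using (∃; ∃-syntax; _×_; _,_; proj₁; proj₂)
open import Data.Sum.Base using (_⊎_; inj₁; inj₂; map₂; swap)
open import Data.Unit.Base using (tt)
open import Function.Base using (_∘_)
open import Function.Bundles using (module Equivalence)
open import Relation.Binary.PropositionalEquality
  using (_≡_; _≢_; refl; sym; trans; cong; cong₂; subst; subst₂; module ≡-Reasoning)
open import Relation.Nullary.Decidable.Core using (yes; no; ¬?)
open import Relation.Nullary.Negation.Core using (¬_; contradiction)

private variable
  x y z w i j l m : ℕ
  a b c a′ b′ : Term
  A B C A′ B′ G : Formula
  Γ : List Formula
  ρ : Assignment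
  T : Theory

-- Substitution

-- `does (x ≟ y)` computes to `x ≡ᵇ y`. Abstracting that Boolean together with this view reduces the
-- conditionals in substitution and in counting occurrences, and supplies the equation or inequation
-- at the same time.
data Comparison (x y : ℕ) : Bool → Set where
  same : x ≡ y → Comparison x y true
  diff : x ≢ y → Comparison x y false

compare-≡ᵇ : ∀ x y → Comparison x y (x ≡ᵇ y)
compare-≡ᵇ zero    zero    = same refl
compare-≡ᵇ zero    (suc y) = diff λ ()
compare-≡ᵇ (suc x) zero    = diff λ ()
compare-≡ᵇ (suc x) (suc y) with x ≡ᵇ y | compare-≡ᵇ x y
... | _ | same p = same (cong suc p)
... | _ | diff p = diff (p ∘ suc-injective)

≡ᵇ-refl : ∀ x → (x ≡ᵇ x) ≡ true
≡ᵇ-refl zero    = refl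
≡ᵇ-refl (suc x) = ≡ᵇ-refl x

≢⇒≡ᵇ-false : x ≢ y → (x ≡ᵇ y) ≡ false
≢⇒≡ᵇ-false {x} {y} x≢y with x ≡ᵇ y | compare-≡ᵇ x y
... | _ | same p = contradiction p x≢y
... | _ | diff _ = refl

+-zero⁻ : ∀ m {n} → m + n ≡ 0 → m ≡ 0 × n ≡ 0
+-zero⁻ zero p = refl , p

Closed : Term → Set
Closed a = ∀ x → NotIn x a

numeral-closed : ∀ i → Closed (numeral i)
numeral-closed zero    x = refl
numeral-closed (suc i) x = numeral-closed i x

NotIn-var : x ≢ y → NotIn x (var y)
NotIn-var x≢y rewrite ≢⇒≡ᵇ-false x≢y = refl

+-zero⁺ : ∀ {m n} → m ≡ 0 → n ≡ 0 → m + n ≡ 0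
+-zero⁺ refl q = q

-- A threshold rather than a single variable: the sum of the thresholds of several terms is a
-- variable fresh for all of them.
fresh : ∀ a → ∃[ m ] (∀ {x} → m ≤ x → NotIn x a)
fresh (var y) = suc y , λ y<x → NotIn-var (>⇒≢ y<x)
fresh 𝟎       = 0 , λ _ → refl
fresh (s a)   = fresh a
fresh (a ⊕ b) =
  let m , p = fresh a
      n , q = fresh b
  in m + n , λ le → +-zero⁺ (p (m+n≤o⇒m≤o m le)) (q (m+n≤o⇒n≤o m le))
fresh (a ⊗ b) =
  let m , p = fresh a
      n , q = fresh b
  in m + n , λ le → +-zero⁺ (p (m+n≤o⇒m≤o m le)) (q (m+n≤o⇒n≤o m le))

NotFree-all-≡ : ∀ x A → NotFree x (all x A)
NotFree-all-≡ x A rewrite ≡ᵇ-refl x = refl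

NotFree-all : ∀ x y A → NotFree x A → NotFree x (all y A)
NotFree-all x y A p with x ≡ᵇ y
... | true  = refl
... | false = p

NotFree-all⁻ : ∀ A → x ≢ y → NotFree x (all y A) → NotFree x A
NotFree-all⁻ A x≢y p rewrite ≢⇒≡ᵇ-false x≢y = p

subst-idᵗ : ∀ x a → a [ x := var x ]ᵗ ≡ a
subst-idᵗ x (var y) with x ≡ᵇ y | compare-≡ᵇ x y
... | _ | same refl = refl
... | _ | diff _    = refl
subst-idᵗ x 𝟎       = refl
subst-idᵗ x (s a)   = cong s (subst-idᵗ x a)
subst-idᵗ x (a ⊕ b) = cong₂ _⊕_ (subst-idᵗ x a) (subst-idᵗ x b)
subst-idᵗ x (a ⊗ b) = cong₂ _⊗_ (subst-idᵗ x a) (subst-idᵗ x b)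

subst-id : ∀ x A → A [ x := var x ] ≡ A
subst-id x (a ≐ b) = cong₂ _≐_ (subst-idᵗ x a) (subst-idᵗ x b)
subst-id x (a ≼ b) = cong₂ _≼_ (subst-idᵗ x a) (subst-idᵗ x b)
subst-id x (~ A)   = cong ~_ (subst-id x A)
subst-id x (A ∧ B) = cong₂ _∧_ (subst-id x A) (subst-id x B)
subst-id x (A ∨ B) = cong₂ _∨_ (subst-id x A) (subst-id x B)
subst-id x (A ⇒ B) = cong₂ _⇒_ (subst-id x A) (subst-id x B)
subst-id x (all y A) with x ≡ᵇ y
... | true  = refl
... | false = cong (all y) (subst-id x A)
subst-id x (ex y A) with x ≡ᵇ y
... | true  = refl
... | false = cong (ex y) (subst-id x A)

subst-absentᵗ : ∀ b → NotIn x b → b [ x := a ]ᵗ ≡ b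
subst-absentᵗ {x} (var y) p with x ≡ᵇ y
subst-absentᵗ (var y) () | true
... | false = refl
subst-absentᵗ 𝟎       p = refl
subst-absentᵗ (s b)   p = cong s (subst-absentᵗ b p)
subst-absentᵗ {x} (b ⊕ c) p =
  let q , r = +-zero⁻ (occurrences x b) p in cong₂ _⊕_ (subst-absentᵗ b q) (subst-absentᵗ c r)
subst-absentᵗ {x} (b ⊗ c) p =
  let q , r = +-zero⁻ (occurrences x b) p in cong₂ _⊗_ (subst-absentᵗ b q) (subst-absentᵗ c r)

subst-absent : ∀ A → NotFree x A → A [ x := a ] ≡ A
subst-absent {x} (b ≐ c) p =
  let q , r = +-zero⁻ (occurrences x b) p in cong₂ _≐_ (subst-absentᵗ b q) (subst-absentᵗ c r)
subst-absent {x} (b ≼ c) p =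
  let q , r = +-zero⁻ (occurrences x b) p in cong₂ _≼_ (subst-absentᵗ b q) (subst-absentᵗ c r)
subst-absent (~ A) p = cong ~_ (subst-absent A p)
subst-absent {x} (A ∧ B) p =
  let q , r = +-zero⁻ (freeOccurrences x A) p in cong₂ _∧_ (subst-absent A q) (subst-absent B r)
subst-absent {x} (A ∨ B) p =
  let q , r = +-zero⁻ (freeOccurrences x A) p in cong₂ _∨_ (subst-absent A q) (subst-absent B r)
subst-absent {x} (A ⇒ B) p =
  let q , r = +-zero⁻ (freeOccurrences x A) p in cong₂ _⇒_ (subst-absent A q) (subst-absent B r)
subst-absent {x} (all y A) p with x ≡ᵇ y
... | true  = refl
... | false = cong (all y) (subst-absent A p)
subst-absent {x} (ex y A) p with x ≡ᵇ y
... | true  = refl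
... | false = cong (ex y) (subst-absent A p)

subst-closed : Closed b → b [ x := a ]ᵗ ≡ b
subst-closed {b} {x} cl = subst-absentᵗ b (cl x)

subst-numeral : ∀ i → numeral i [ x := a ]ᵗ ≡ numeral i
subst-numeral i = subst-absentᵗ (numeral i) (numeral-closed i _)

subst-commᵗ : x ≢ y → Closed a → Closed b → ∀ c →
              c [ x := a ]ᵗ [ y := b ]ᵗ ≡ c [ y := b ]ᵗ [ x := a ]ᵗ
subst-commᵗ {x} {y} {a} {b} x≢y cla clb (var z)
  with x ≡ᵇ z in e | compare-≡ᵇ x z | y ≡ᵇ z in e′ | compare-≡ᵇ y z
... | _ | same refl | _ | same refl = contradiction refl x≢y
... | _ | same refl | _ | diff _ rewrite e = subst-closed cla
... | _ | diff _ | _ | same refl rewrite e′ = sym (subst-closed clb)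
... | _ | diff _ | _ | diff _ rewrite e | e′ = refl
subst-commᵗ x≢y cla clb 𝟎       = refl
subst-commᵗ x≢y cla clb (s c)   = cong s (subst-commᵗ x≢y cla clb c)
subst-commᵗ x≢y cla clb (c ⊕ d) = cong₂ _⊕_ (subst-commᵗ x≢y cla clb c) (subst-commᵗ x≢y cla clb d)
subst-commᵗ x≢y cla clb (c ⊗ d) = cong₂ _⊗_ (subst-commᵗ x≢y cla clb c) (subst-commᵗ x≢y cla clb d)

-- Each inserted term is closed, hence untouched by the other substitution.
subst-comm : x ≢ y → Closed a → Closed b → ∀ A →
             A [ x := a ] [ y := b ] ≡ A [ y := b ] [ x := a ]
subst-comm x≢y cla clb (c ≐ d) = cong₂ _≐_ (subst-commᵗ x≢y cla clb c) (subst-commᵗ x≢y cla clb d)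
subst-comm x≢y cla clb (c ≼ d) = cong₂ _≼_ (subst-commᵗ x≢y cla clb c) (subst-commᵗ x≢y cla clb d)
subst-comm x≢y cla clb (~ A)   = cong ~_ (subst-comm x≢y cla clb A)
subst-comm x≢y cla clb (A ∧ B) = cong₂ _∧_ (subst-comm x≢y cla clb A) (subst-comm x≢y cla clb B)
subst-comm x≢y cla clb (A ∨ B) = cong₂ _∨_ (subst-comm x≢y cla clb A) (subst-comm x≢y cla clb B)
subst-comm x≢y cla clb (A ⇒ B) = cong₂ _⇒_ (subst-comm x≢y cla clb A) (subst-comm x≢y cla clb B)
subst-comm {x} {y} x≢y cla clb (all z A) with x ≡ᵇ z in e | y ≡ᵇ z in e′
... | true  | true  rewrite e | e′ = refl
... | true  | false rewrite e | e′ = refl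
... | false | true  rewrite e | e′ = refl
... | false | false rewrite e | e′ = cong (all z) (subst-comm x≢y cla clb A)
subst-comm {x} {y} x≢y cla clb (ex z A) with x ≡ᵇ z in e | y ≡ᵇ z in e′
... | true  | true  rewrite e | e′ = refl
... | true  | false rewrite e | e′ = refl
... | false | true  rewrite e | e′ = refl
... | false | false rewrite e | e′ = cong (ex z) (subst-comm x≢y cla clb A)

subst-transᵗ : ∀ c → NotIn y c → c [ x := var y ]ᵗ [ y := b ]ᵗ ≡ c [ x := b ]ᵗ
subst-transᵗ {y} {x} (var z) p with x ≡ᵇ z
... | true rewrite ≡ᵇ-refl y = refl
... | false = subst-absentᵗ {y} (var z) p
subst-transᵗ 𝟎       p = refl
subst-transᵗ (s c)   p = cong s (subst-transᵗ c p)
subst-transᵗ {y} (c ⊕ d) p =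
  let q , r = +-zero⁻ (occurrences y c) p in cong₂ _⊕_ (subst-transᵗ c q) (subst-transᵗ d r)
subst-transᵗ {y} (c ⊗ d) p =
  let q , r = +-zero⁻ (occurrences y c) p in cong₂ _⊗_ (subst-transᵗ c q) (subst-transᵗ d r)

subst-trans : ∀ A → FreeFor (var y) x A → NotFree y A →
              A [ x := var y ] [ y := b ] ≡ A [ x := b ]
subst-trans {y} (c ≐ d) f p =
  let q , r = +-zero⁻ (occurrences y c) p in cong₂ _≐_ (subst-transᵗ c q) (subst-transᵗ d r)
subst-trans {y} (c ≼ d) f p =
  let q , r = +-zero⁻ (occurrences y c) p in cong₂ _≼_ (subst-transᵗ c q) (subst-transᵗ d r)
subst-trans (~ A) f p = cong ~_ (subst-trans A f p)
subst-trans {y} (A ∧ B) (f , g) p =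
  let q , r = +-zero⁻ (freeOccurrences y A) p in cong₂ _∧_ (subst-trans A f q) (subst-trans B g r)
subst-trans {y} (A ∨ B) (f , g) p =
  let q , r = +-zero⁻ (freeOccurrences y A) p in cong₂ _∨_ (subst-trans A f q) (subst-trans B g r)
subst-trans {y} (A ⇒ B) (f , g) p =
  let q , r = +-zero⁻ (freeOccurrences y A) p in cong₂ _⇒_ (subst-trans A f q) (subst-trans B g r)
subst-trans {y} {x} {b} (all z A) (inj₁ q) p =
  trans (cong (_[ y := b ]) (subst-absent {x} {var y} (all z A) q))
        (trans (subst-absent (all z A) p) (sym (subst-absent {x} {b} (all z A) q)))
subst-trans {y} {x} (all z A) (inj₂ (z∉y , f)) p with x ≡ᵇ z
... | true = subst-absent (all z A) p
... | false with y ≡ᵇ z | compare-≡ᵇ y z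
-- A binder of `y` itself would capture the inserted variable, which `FreeFor` forbids.
...   | _ | same refl rewrite ≡ᵇ-refl y = contradiction z∉y λ ()
...   | _ | diff _    = cong (all z) (subst-trans A f p)
subst-trans {y} {x} {b} (ex z A) (inj₁ q) p =
  trans (cong (_[ y := b ]) (subst-absent {x} {var y} (ex z A) q))
        (trans (subst-absent (ex z A) p) (sym (subst-absent {x} {b} (ex z A) q)))
subst-trans {y} {x} (ex z A) (inj₂ (z∉y , f)) p with x ≡ᵇ z
... | true = subst-absent (ex z A) p
... | false with y ≡ᵇ z | compare-≡ᵇ y z
...   | _ | same refl rewrite ≡ᵇ-refl y = contradiction z∉y λ ()
...   | _ | diff _    = cong (ex z) (subst-trans A f p)

FreeFor-closed : Closed a → ∀ x A → FreeFor a x A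
FreeFor-closed cl x (b ≐ c)   = tt
FreeFor-closed cl x (b ≼ c)   = tt
FreeFor-closed cl x (~ A)     = FreeFor-closed cl x A
FreeFor-closed cl x (A ∧ B)   = FreeFor-closed cl x A , FreeFor-closed cl x B
FreeFor-closed cl x (A ∨ B)   = FreeFor-closed cl x A , FreeFor-closed cl x B
FreeFor-closed cl x (A ⇒ B)   = FreeFor-closed cl x A , FreeFor-closed cl x B
FreeFor-closed cl x (all y A) = inj₂ (cl y , FreeFor-closed cl x A)
FreeFor-closed cl x (ex y A)  = inj₂ (cl y , FreeFor-closed cl x A)

FreeFor-self : ∀ x A → FreeFor (var x) x A
FreeFor-self x (b ≐ c)   = tt
FreeFor-self x (b ≼ c)   = tt
FreeFor-self x (~ A)     = FreeFor-self x A
FreeFor-self x (A ∧ B)   = FreeFor-self x A , FreeFor-self x B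
FreeFor-self x (A ∨ B)   = FreeFor-self x A , FreeFor-self x B
FreeFor-self x (A ⇒ B)   = FreeFor-self x A , FreeFor-self x B
FreeFor-self x (all y A) with x ≡ᵇ y | compare-≡ᵇ x y
... | _ | same _   = inj₁ refl
... | _ | diff x≢y = inj₂ (NotIn-var (x≢y ∘ sym) , FreeFor-self x A)
FreeFor-self x (ex y A) with x ≡ᵇ y | compare-≡ᵇ x y
... | _ | same _   = inj₁ refl
... | _ | diff x≢y = inj₂ (NotIn-var (x≢y ∘ sym) , FreeFor-self x A)

FreeFor-absent : ∀ A → NotFree x A → FreeFor a x A
FreeFor-absent (b ≐ c) p = tt
FreeFor-absent (b ≼ c) p = tt
FreeFor-absent (~ A)   p = FreeFor-absent A p
FreeFor-absent {x} (A ∧ B) p =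
  let q , r = +-zero⁻ (freeOccurrences x A) p in FreeFor-absent A q , FreeFor-absent B r
FreeFor-absent {x} (A ∨ B) p =
  let q , r = +-zero⁻ (freeOccurrences x A) p in FreeFor-absent A q , FreeFor-absent B r
FreeFor-absent {x} (A ⇒ B) p =
  let q , r = +-zero⁻ (freeOccurrences x A) p in FreeFor-absent A q , FreeFor-absent B r
FreeFor-absent (all y A) p = inj₁ p
FreeFor-absent (ex y A)  p = inj₁ p

NotIn-subst : ∀ b → NotIn x a → x ≡ y ⊎ NotIn x b → NotIn x (b [ y := a ]ᵗ)
NotIn-subst {y = y} (var z) p q with y ≡ᵇ z | compare-≡ᵇ y z
... | _ | same _ = p
NotIn-subst (var z) p (inj₁ refl) | _ | diff x≢z = NotIn-var x≢z
NotIn-subst (var z) p (inj₂ q)    | _ | diff _   = q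
NotIn-subst 𝟎       p q = refl
NotIn-subst {x} {a} (s b) p q = NotIn-subst {x} {a} b p q
NotIn-subst {x} {a} (b ⊕ c) p q = +-zero⁺
  (NotIn-subst {x} {a} b p (map₂ (proj₁ ∘ +-zero⁻ (occurrences x b)) q))
  (NotIn-subst {x} {a} c p (map₂ (proj₂ ∘ +-zero⁻ (occurrences x b)) q))
NotIn-subst {x} {a} (b ⊗ c) p q = +-zero⁺
  (NotIn-subst {x} {a} b p (map₂ (proj₁ ∘ +-zero⁻ (occurrences x b)) q))
  (NotIn-subst {x} {a} c p (map₂ (proj₂ ∘ +-zero⁻ (occurrences x b)) q))

NotFree-subst : ∀ A → NotIn x a → x ≡ y ⊎ NotFree x A → NotFree x (A [ y := a ])
NotFree-subst {x} {a} (b ≐ c) p q = +-zero⁺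
  (NotIn-subst {x} {a} b p (map₂ (proj₁ ∘ +-zero⁻ (occurrences x b)) q))
  (NotIn-subst {x} {a} c p (map₂ (proj₂ ∘ +-zero⁻ (occurrences x b)) q))
NotFree-subst {x} {a} (b ≼ c) p q = +-zero⁺
  (NotIn-subst {x} {a} b p (map₂ (proj₁ ∘ +-zero⁻ (occurrences x b)) q))
  (NotIn-subst {x} {a} c p (map₂ (proj₂ ∘ +-zero⁻ (occurrences x b)) q))
NotFree-subst {x} {a} (~ A) p q = NotFree-subst {x} {a} A p q
NotFree-subst {x} {a} (A ∧ B) p q = +-zero⁺
  (NotFree-subst {x} {a} A p (map₂ (proj₁ ∘ +-zero⁻ (freeOccurrences x A)) q))
  (NotFree-subst {x} {a} B p (map₂ (proj₂ ∘ +-zero⁻ (freeOccurrences x A)) q))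
NotFree-subst {x} {a} (A ∨ B) p q = +-zero⁺
  (NotFree-subst {x} {a} A p (map₂ (proj₁ ∘ +-zero⁻ (freeOccurrences x A)) q))
  (NotFree-subst {x} {a} B p (map₂ (proj₂ ∘ +-zero⁻ (freeOccurrences x A)) q))
NotFree-subst {x} {a} (A ⇒ B) p q = +-zero⁺
  (NotFree-subst {x} {a} A p (map₂ (proj₁ ∘ +-zero⁻ (freeOccurrences x A)) q))
  (NotFree-subst {x} {a} B p (map₂ (proj₂ ∘ +-zero⁻ (freeOccurrences x A)) q))
NotFree-subst {x} {a} {y} (all z A) p q with y ≡ᵇ z | compare-≡ᵇ y z
NotFree-subst (all z A) p (inj₁ refl) | _ | same refl = NotFree-all-≡ z A
NotFree-subst (all z A) p (inj₂ q)    | _ | same _    = q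
NotFree-subst {x} {a} (all z A) p q   | _ | diff _ with x ≡ᵇ z
... | true  = refl
... | false = NotFree-subst {x} {a} A p q
NotFree-subst {x} {a} {y} (ex z A) p q with y ≡ᵇ z | compare-≡ᵇ y z
NotFree-subst (ex z A) p (inj₁ refl) | _ | same refl = NotFree-all-≡ z A
NotFree-subst (ex z A) p (inj₂ q)    | _ | same _    = q
NotFree-subst {x} {a} (ex z A) p q   | _ | diff _ with x ≡ᵇ z
... | true  = refl
... | false = NotFree-subst {x} {a} A p q

-- Length after a substitution

∣_∣ᵗ : Term → ℕ
∣ a ∣ᵗ = length (symbolsᵗ a)

length-infix : ∀ (p q : List Symbol) o r →
               length (p ++ o ∷ q ++ [ r ]) ≡ 2 + (length p + length q)
length-infix p q o r
  rewrite length-++ p {o ∷ q ++ [ r ]} | length-++ q {[ r ]} =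
  solve 2 (λ m n → m :+ (con 1 :+ (n :+ con 1)) := con 2 :+ (m :+ n)) refl
    (length p) (length q)
  where open +-*-Solver

length-relation : ∀ (p q : List Symbol) o → length (p ++ o ∷ q) ≡ 1 + (length p + length q)
length-relation p q o rewrite length-++ p {o ∷ q} = +-suc (length p) (length q)

-- m′ is the length after replacing o symbols of a string of length m by strings of length l.
record Replaced (l o m m′ : ℕ) : Set where
  constructor replaced
  field balance : m′ + o ≡ m + o * l

extend : ∀ c {l o m m′} → Replaced l o m m′ → Replaced l o (c + m) (c + m′)
extend c {l} {o} {m} {m′} (replaced p) =
  replaced (trans (+-assoc c m′ o) (trans (cong (c +_) p) (sym (+-assoc c m (o * l)))))

append : ∀ {l o o′ m m′ n n′} → Replaced l o m m′ → Replaced l o′ n n′ →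
         Replaced l (o + o′) (m + n) (m′ + n′)
append {l} {o} {o′} {m} {m′} {n} {n′} (replaced p) (replaced q) = replaced (begin
  (m′ + n′) + (o + o′)           ≡⟨ solve 4 (λ m n o p → (m :+ n) :+ (o :+ p) := (m :+ o) :+ (n :+ p)) refl m′ n′ o o′ ⟩
  (m′ + o) + (n′ + o′)           ≡⟨ cong₂ _+_ p q ⟩
  (m + o * l) + (n + o′ * l)     ≡⟨ solve 5 (λ m n o p l → (m :+ o :* l) :+ (n :+ p :* l) := (m :+ n) :+ (o :+ p) :* l) refl m n o o′ l ⟩
  (m + n) + (o + o′) * l         ∎)
  where open ≡-Reasoning
        open +-*-Solver

length-substᵗ : ∀ {x a} b → Replaced ∣ a ∣ᵗ (occurrences x b) ∣ b ∣ᵗ ∣ b [ x := a ]ᵗ ∣ᵗ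
length-substᵗ {x} {a} (var y) with x ≡ᵇ y
... | true  = replaced (trans (+-comm ∣ a ∣ᵗ 1) (cong suc (sym (+-identityʳ ∣ a ∣ᵗ))))
... | false = replaced refl
length-substᵗ 𝟎       = replaced refl
length-substᵗ (s b)   = extend 1 (length-substᵗ b)
length-substᵗ {x} {a} (b ⊕ c)
  rewrite length-infix (symbolsᵗ (b [ x := a ]ᵗ)) (symbolsᵗ (c [ x := a ]ᵗ)) ′+ ′⟩
        | length-infix (symbolsᵗ b) (symbolsᵗ c) ′+ ′⟩ =
  extend 3 (append (length-substᵗ b) (length-substᵗ c))
length-substᵗ {x} {a} (b ⊗ c)
  rewrite length-infix (symbolsᵗ (b [ x := a ]ᵗ)) (symbolsᵗ (c [ x := a ]ᵗ)) ′· ′⟩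
        | length-infix (symbolsᵗ b) (symbolsᵗ c) ′· ′⟩ =
  extend 3 (append (length-substᵗ b) (length-substᵗ c))

length-subst : ∀ {x a} A → Replaced ∣ a ∣ᵗ (freeOccurrences x A) ∣ A ∣ ∣ A [ x := a ] ∣
length-subst {x} {a} (b ≐ c)
  rewrite length-relation (symbolsᵗ (b [ x := a ]ᵗ)) (symbolsᵗ (c [ x := a ]ᵗ)) ′=
        | length-relation (symbolsᵗ b) (symbolsᵗ c) ′= =
  extend 1 (append (length-substᵗ b) (length-substᵗ c))
length-subst {x} {a} (b ≼ c)
  rewrite length-relation (symbolsᵗ (b [ x := a ]ᵗ)) (symbolsᵗ (c [ x := a ]ᵗ)) ′≤
        | length-relation (symbolsᵗ b) (symbolsᵗ c) ′≤ =
  extend 1 (append (length-substᵗ b) (length-substᵗ c))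
length-subst (~ A) = extend 1 (length-subst A)
length-subst {x} {a} (A ∧ B)
  rewrite length-infix (symbols (A [ x := a ])) (symbols (B [ x := a ])) ′∧ ′⟩
        | length-infix (symbols A) (symbols B) ′∧ ′⟩ =
  extend 3 (append (length-subst A) (length-subst B))
length-subst {x} {a} (A ∨ B)
  rewrite length-infix (symbols (A [ x := a ])) (symbols (B [ x := a ])) ′∨ ′⟩
        | length-infix (symbols A) (symbols B) ′∨ ′⟩ =
  extend 3 (append (length-subst A) (length-subst B))
length-subst {x} {a} (A ⇒ B)
  rewrite length-infix (symbols (A [ x := a ])) (symbols (B [ x := a ])) ′→ ′⟩
        | length-infix (symbols A) (symbols B) ′→ ′⟩ =
  extend 3 (append (length-subst A) (length-subst B))
length-subst {x} (all y A) with x ≡ᵇ y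
... | true  = replaced refl
... | false = extend 4 (length-subst A)
length-subst {x} (ex y A) with x ≡ᵇ y
... | true  = replaced refl
... | false = extend 4 (length-subst A)

-- Renaming variables

∈-infixˡ : ∀ {X : Set} {u l o r : X} {ps qs} → u ∈ ps → u ∈ l ∷ ps ++ o ∷ qs ++ [ r ]
∈-infixˡ u∈ps = there (∈-++⁺ˡ u∈ps)

∈-infixʳ : ∀ {X : Set} {u l o r : X} ps {qs} → u ∈ qs → u ∈ l ∷ ps ++ o ∷ qs ++ [ r ]
∈-infixʳ ps u∈qs = there (∈-++⁺ʳ ps (there (∈-++⁺ˡ u∈qs)))

∈-relationʳ : ∀ {X : Set} {u o : X} ps {qs} → u ∈ qs → u ∈ ps ++ o ∷ qs
∈-relationʳ ps = ∈-++⁺ʳ ps ∘ there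

infix 4 _#ᵗ_ _#_

-- Absence from the string of symbols; for formulas this includes binders and is stronger than
-- `NotFree`. It is the condition under which renaming to `x` captures nothing.
_#ᵗ_ : ℕ → Term → Set
x #ᵗ a = ′v x ∉ symbolsᵗ a

_#_ : ℕ → Formula → Set
x # A = ′v x ∉ symbols A

#⇒NotIn : ∀ a → x #ᵗ a → NotIn x a
#⇒NotIn {x} (var y) p = NotIn-var {x} {y} λ { refl → p (here refl) }
#⇒NotIn 𝟎       p = refl
#⇒NotIn (s a)   p = #⇒NotIn a (p ∘ there)
#⇒NotIn (a ⊕ b) p = +-zero⁺ (#⇒NotIn a (p ∘ ∈-infixˡ)) (#⇒NotIn b (p ∘ ∈-infixʳ (symbolsᵗ a)))
#⇒NotIn (a ⊗ b) p = +-zero⁺ (#⇒NotIn a (p ∘ ∈-infixˡ)) (#⇒NotIn b (p ∘ ∈-infixʳ (symbolsᵗ a)))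

#⇒NotFree : ∀ A → x # A → NotFree x A
#⇒NotFree (a ≐ b) p = +-zero⁺ (#⇒NotIn a (p ∘ ∈-++⁺ˡ)) (#⇒NotIn b (p ∘ ∈-relationʳ (symbolsᵗ a)))
#⇒NotFree (a ≼ b) p = +-zero⁺ (#⇒NotIn a (p ∘ ∈-++⁺ˡ)) (#⇒NotIn b (p ∘ ∈-relationʳ (symbolsᵗ a)))
#⇒NotFree (~ A)   p = #⇒NotFree A (p ∘ there)
#⇒NotFree (A ∧ B) p = +-zero⁺ (#⇒NotFree A (p ∘ ∈-infixˡ)) (#⇒NotFree B (p ∘ ∈-infixʳ (symbols A)))
#⇒NotFree (A ∨ B) p = +-zero⁺ (#⇒NotFree A (p ∘ ∈-infixˡ)) (#⇒NotFree B (p ∘ ∈-infixʳ (symbols A)))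
#⇒NotFree (A ⇒ B) p = +-zero⁺ (#⇒NotFree A (p ∘ ∈-infixˡ)) (#⇒NotFree B (p ∘ ∈-infixʳ (symbols A)))
#⇒NotFree {x} (all y A) p = NotFree-all x y A (#⇒NotFree A (p ∘ there ∘ there ∘ there ∘ there))
#⇒NotFree {x} (ex y A)  p = NotFree-all x y A (#⇒NotFree A (p ∘ there ∘ there ∘ there ∘ there))

-- Every occurrence of `y` becomes `w`, binding ones included. Renaming therefore acts symbol by
-- symbol, and the new length and the new variables can be read off the string.
module Renaming (y w : ℕ) where

  renᵛ : ℕ → ℕ
  renᵛ x = if x ≡ᵇ y then w else x

  renᵗ : Term → Term
  renᵗ (var x) = var (renᵛ x)
  renᵗ 𝟎       = 𝟎
  renᵗ (s a)   = s (renᵗ a)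
  renᵗ (a ⊕ b) = renᵗ a ⊕ renᵗ b
  renᵗ (a ⊗ b) = renᵗ a ⊗ renᵗ b

  ren : Formula → Formula
  ren (a ≐ b)   = renᵗ a ≐ renᵗ b
  ren (a ≼ b)   = renᵗ a ≼ renᵗ b
  ren (~ A)     = ~ ren A
  ren (A ∧ B)   = ren A ∧ ren B
  ren (A ∨ B)   = ren A ∨ ren B
  ren (A ⇒ B)   = ren A ⇒ ren B
  ren (all x A) = all (renᵛ x) (ren A)
  ren (ex x A)  = ex (renᵛ x) (ren A)

  renˢ : Symbol → Symbol
  renˢ (′v x) = ′v (renᵛ x)
  renˢ c      = c

  map-infix : ∀ l p o q r → map renˢ (l ∷ p ++ o ∷ q ++ [ r ]) ≡
              renˢ l ∷ map renˢ p ++ renˢ o ∷ map renˢ q ++ [ renˢ r ]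
  map-infix l p o q r
    rewrite map-++ renˢ p (o ∷ q ++ [ r ]) | map-++ renˢ q [ r ] = refl

  symbols-renᵗ : ∀ a → symbolsᵗ (renᵗ a) ≡ map renˢ (symbolsᵗ a)
  symbols-renᵗ (var x) = refl
  symbols-renᵗ 𝟎       = refl
  symbols-renᵗ (s a)   = cong (′s ∷_) (symbols-renᵗ a)
  symbols-renᵗ (a ⊕ b)
    rewrite map-infix ′⟨ (symbolsᵗ a) ′+ (symbolsᵗ b) ′⟩ | symbols-renᵗ a | symbols-renᵗ b = refl
  symbols-renᵗ (a ⊗ b)
    rewrite map-infix ′⟨ (symbolsᵗ a) ′· (symbolsᵗ b) ′⟩ | symbols-renᵗ a | symbols-renᵗ b = refl

  symbols-ren : ∀ A → symbols (ren A) ≡ map renˢ (symbols A)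
  symbols-ren (a ≐ b)
    rewrite map-++ renˢ (symbolsᵗ a) (′= ∷ symbolsᵗ b) | symbols-renᵗ a | symbols-renᵗ b = refl
  symbols-ren (a ≼ b)
    rewrite map-++ renˢ (symbolsᵗ a) (′≤ ∷ symbolsᵗ b) | symbols-renᵗ a | symbols-renᵗ b = refl
  symbols-ren (~ A) = cong (′¬ ∷_) (symbols-ren A)
  symbols-ren (A ∧ B)
    rewrite map-infix ′⟨ (symbols A) ′∧ (symbols B) ′⟩ | symbols-ren A | symbols-ren B = refl
  symbols-ren (A ∨ B)
    rewrite map-infix ′⟨ (symbols A) ′∨ (symbols B) ′⟩ | symbols-ren A | symbols-ren B = refl
  symbols-ren (A ⇒ B)
    rewrite map-infix ′⟨ (symbols A) ′→ (symbols B) ′⟩ | symbols-ren A | symbols-ren B = refl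
  symbols-ren (all x A) rewrite symbols-ren A = refl
  symbols-ren (ex x A)  rewrite symbols-ren A = refl

  length-ren : ∀ A → ∣ ren A ∣ ≡ ∣ A ∣
  length-ren A = trans (cong length (symbols-ren A)) (length-map renˢ (symbols A))

  ′v∈ren⁻ : ∀ A → ′v x ∈ symbols (ren A) → ∃[ z ] ′v z ∈ symbols A × x ≡ renᵛ z
  ′v∈ren⁻ {x} A p with ∈-map⁻ renˢ (subst (′v x ∈_) (symbols-ren A) p)
  ... | ′v z , q , refl = z , q , refl
  ... | ′0 , _ , ()
  ... | ′s , _ , ()
  ... | ′+ , _ , ()
  ... | ′· , _ , ()
  ... | ′= , _ , ()
  ... | ′≤ , _ , ()
  ... | ′¬ , _ , ()
  ... | ′∧ , _ , ()
  ... | ′∨ , _ , ()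
  ... | ′→ , _ , ()
  ... | ′∀ , _ , ()
  ... | ′∃ , _ , ()
  ... | ′⟨ , _ , ()
  ... | ′⟩ , _ , ()

  renᵛ-≡ : x ≡ y → renᵛ x ≡ w
  renᵛ-≡ refl rewrite ≡ᵇ-refl y = refl

  renᵛ-≢ : x ≢ y → renᵛ x ≡ x
  renᵛ-≢ x≢y rewrite ≢⇒≡ᵇ-false x≢y = refl

  module _ (y≢w : y ≢ w) where

    renᵛ-avoids : ∀ z → y ≢ renᵛ z
    renᵛ-avoids z with z ≡ᵇ y | compare-≡ᵇ z y
    ... | _ | same _   = y≢w
    ... | _ | diff z≢y = z≢y ∘ sym

    #-ren : ∀ A → y # ren A
    #-ren A p = let z , _ , q = ′v∈ren⁻ A p in renᵛ-avoids z q

  -- Apart from `w` itself only `y` is sent to `w`, so `renᵛ` is injective away from `w`.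
  ≡ᵇ-renᵛ : x ≢ w → z ≢ w → (renᵛ x ≡ᵇ renᵛ z) ≡ (x ≡ᵇ z)
  ≡ᵇ-renᵛ {x} {z} x≢w z≢w
    with x ≡ᵇ y | compare-≡ᵇ x y | z ≡ᵇ y | compare-≡ᵇ z y
  ... | _ | same refl | _ | same refl rewrite ≡ᵇ-refl w | ≡ᵇ-refl y = refl
  ... | _ | same refl | _ | diff z≢y = trans (≢⇒≡ᵇ-false (z≢w ∘ sym)) (sym (≢⇒≡ᵇ-false (z≢y ∘ sym)))
  ... | _ | diff x≢y | _ | same refl = trans (≢⇒≡ᵇ-false x≢w) (sym (≢⇒≡ᵇ-false x≢y))
  ... | _ | diff _   | _ | diff _    = refl

  occurrences-ren : ∀ a → x ≢ w → w #ᵗ a → occurrences (renᵛ x) (renᵗ a) ≡ occurrences x a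
  occurrences-ren (var z) x≢w p
    rewrite ≡ᵇ-renᵛ {z = z} x≢w (λ { refl → p (here refl) }) = refl
  occurrences-ren 𝟎     x≢w p = refl
  occurrences-ren (s a) x≢w p = occurrences-ren a x≢w (p ∘ there)
  occurrences-ren (a ⊕ b) x≢w p = cong₂ _+_
    (occurrences-ren a x≢w (p ∘ ∈-infixˡ)) (occurrences-ren b x≢w (p ∘ ∈-infixʳ (symbolsᵗ a)))
  occurrences-ren (a ⊗ b) x≢w p = cong₂ _+_
    (occurrences-ren a x≢w (p ∘ ∈-infixˡ)) (occurrences-ren b x≢w (p ∘ ∈-infixʳ (symbolsᵗ a)))

  freeOccurrences-ren : ∀ A → x ≢ w → w # A → freeOccurrences (renᵛ x) (ren A) ≡ freeOccurrences x A
  freeOccurrences-ren (a ≐ b) x≢w p = cong₂ _+_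
    (occurrences-ren a x≢w (p ∘ ∈-++⁺ˡ)) (occurrences-ren b x≢w (p ∘ ∈-relationʳ (symbolsᵗ a)))
  freeOccurrences-ren (a ≼ b) x≢w p = cong₂ _+_
    (occurrences-ren a x≢w (p ∘ ∈-++⁺ˡ)) (occurrences-ren b x≢w (p ∘ ∈-relationʳ (symbolsᵗ a)))
  freeOccurrences-ren (~ A) x≢w p = freeOccurrences-ren A x≢w (p ∘ there)
  freeOccurrences-ren (A ∧ B) x≢w p = cong₂ _+_
    (freeOccurrences-ren A x≢w (p ∘ ∈-infixˡ)) (freeOccurrences-ren B x≢w (p ∘ ∈-infixʳ (symbols A)))
  freeOccurrences-ren (A ∨ B) x≢w p = cong₂ _+_
    (freeOccurrences-ren A x≢w (p ∘ ∈-infixˡ)) (freeOccurrences-ren B x≢w (p ∘ ∈-infixʳ (symbols A)))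
  freeOccurrences-ren (A ⇒ B) x≢w p = cong₂ _+_
    (freeOccurrences-ren A x≢w (p ∘ ∈-infixˡ)) (freeOccurrences-ren B x≢w (p ∘ ∈-infixʳ (symbols A)))
  freeOccurrences-ren (all z A) x≢w p
    rewrite ≡ᵇ-renᵛ {z = z} x≢w (λ { refl → p (there (there (here refl))) })
          | freeOccurrences-ren A x≢w (p ∘ there ∘ there ∘ there ∘ there) = refl
  freeOccurrences-ren (ex z A) x≢w p
    rewrite ≡ᵇ-renᵛ {z = z} x≢w (λ { refl → p (there (there (here refl))) })
          | freeOccurrences-ren A x≢w (p ∘ there ∘ there ∘ there ∘ there) = refl

  NotFree-ren : ∀ A → x ≢ w → w # A → NotFree x A → NotFree (renᵛ x) (ren A)
  NotFree-ren A x≢w w#A p = trans (freeOccurrences-ren A x≢w w#A) p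

-- Otherwise all `m` numbers would have positions in a list shorter than `m`, and two of them would
-- share a position.
unlisted : ∀ {m} (xs : List ℕ) → length xs < m → ∃[ w ] w < m × w ∉ xs
unlisted {m} xs l<m with all? {m} (λ i → toℕ i ∈? xs)
... | no ¬p = let i , q = ¬∀⟶∃¬ m _ (λ i → toℕ i ∈? xs) ¬p in toℕ i , toℕ<n i , q
... | yes p =
  let i , j , i<j , e = pigeonhole l<m (index ∘ p)
  in contradiction (trans (lookup-index (p i))
       (trans (cong (lookup xs) e) (sym (lookup-index (p j))))) (<⇒≢ i<j)

fresh-variable : ∀ {m} A → ∣ A ∣ < m → ∃[ w ] w < m × w # A
fresh-variable A l<m =
  -- 14 is the offset of the variable codes: subtracting it recovers the index of a variable and
  -- sends every other symbol to 0, which at worst rules out one more index.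
  let w , w<m , w∉ = unlisted (map (λ c → symbolCode c ∸ 14) (symbols A))
        (subst (_< _) (sym (length-map _ (symbols A))) l<m)
  in w , w<m , w∉ ∘ ∈-map⁺ (λ c → symbolCode c ∸ 14)

-- Natural deduction

wk : T ∣ Γ ⊢ A → T ∣ B ∷ Γ ⊢ A
wk = weak there

close : T ⊢ A → T ∣ Γ ⊢ A
close = weak λ ()

h₀ : T ∣ A ∷ Γ ⊢ A
h₀ = hyp (here refl)

h₁ : T ∣ B ∷ A ∷ Γ ⊢ A
h₁ = hyp (there (here refl))

cut : T ∣ Γ ⊢ A → T ∣ A ∷ Γ ⊢ B → T ∣ Γ ⊢ B
cut p q = ⇒E (⇒I q) p

-- The derivation of `B` takes place over `A` alone, so the variable conditions of `∀I` and `∃E`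
-- used in it do not concern the arbitrary context `Γ`.
cut₁ : T ∣ A ∷ [] ⊢ B → T ∣ Γ ⊢ A → T ∣ Γ ⊢ B
cut₁ p q = ⇒E (close (⇒I p)) q

cut₂ : T ∣ B ∷ A ∷ [] ⊢ C → T ∣ Γ ⊢ B → T ∣ Γ ⊢ A → T ∣ Γ ⊢ C
cut₂ p q r = ⇒E (⇒E (close (⇒I (⇒I p))) r) q

absurd : T ∣ Γ ⊢ A → T ∣ Γ ⊢ ~ A → T ∣ Γ ⊢ C
absurd p q = ¬¬E (¬I (wk p) (wk q))

⊢-≡ : A ≡ B → T ∣ Γ ⊢ A → T ∣ Γ ⊢ B
⊢-≡ refl p = p

∀E-self : T ∣ Γ ⊢ all x A → T ∣ Γ ⊢ A
∀E-self {x = x} {A} p = ⊢-≡ (subst-id x A) (∀E (var x) (FreeFor-self x A) p)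

∃I-self : T ∣ Γ ⊢ A → T ∣ Γ ⊢ ex x A
∃I-self {A = A} {x} p = ∃I (var x) (FreeFor-self x A) (⊢-≡ (sym (subst-id x A)) p)

subst-var : ∀ x a → var x [ x := a ]ᵗ ≡ a
subst-var x a rewrite ≡ᵇ-refl x = refl

=E-≡ : ∀ A → FreeFor a x A → FreeFor b x A → A [ x := a ] ≡ A′ → A [ x := b ] ≡ B′ →
       T ∣ Γ ⊢ a ≐ b → T ∣ Γ ⊢ A′ → T ∣ Γ ⊢ B′
=E-≡ A f g refl refl p q = =E A f g p q

≐-sym : T ∣ Γ ⊢ a ≐ b → T ∣ Γ ⊢ b ≐ a
≐-sym {a = a} {b} p =
  let x , x∉ = fresh a in
  =E-≡ (var x ≐ a) tt tt
    (cong₂ _≐_ (subst-var x a) (subst-absentᵗ a (x∉ ≤-refl)))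
    (cong₂ _≐_ (subst-var x b) (subst-absentᵗ a (x∉ ≤-refl)))
    p (=I a)

≐-trans : T ∣ Γ ⊢ a ≐ b → T ∣ Γ ⊢ b ≐ c → T ∣ Γ ⊢ a ≐ c
≐-trans {a = a} {b} {c} p q =
  let x , x∉ = fresh a in
  =E-≡ (a ≐ var x) tt tt
    (cong₂ _≐_ (subst-absentᵗ a (x∉ ≤-refl)) (subst-var x b))
    (cong₂ _≐_ (subst-absentᵗ a (x∉ ≤-refl)) (subst-var x c))
    q p

-- Equality elimination in the formula `e [ x := a ]ᵗ ≐ e`: since `a` lacks `x`, the left side no
-- longer contains `x` and stays fixed while the right side changes.
≐-cong : ∀ x e → NotIn x a → T ∣ Γ ⊢ a ≐ b → T ∣ Γ ⊢ e [ x := a ]ᵗ ≐ e [ x := b ]ᵗ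
≐-cong {a} {b = b} x e x∉a p =
  =E-≡ (e [ x := a ]ᵗ ≐ e) tt tt
    (cong (_≐ e [ x := a ]ᵗ) (absent a)) (cong (_≐ e [ x := b ]ᵗ) (absent b)) p (=I _)
  where
  absent : ∀ b → e [ x := a ]ᵗ [ x := b ]ᵗ ≡ e [ x := a ]ᵗ
  absent b = subst-absentᵗ {x} {b} (e [ x := a ]ᵗ) (NotIn-subst {x} {a} e x∉a (inj₁ refl))

≐-s : T ∣ Γ ⊢ a ≐ b → T ∣ Γ ⊢ s a ≐ s b
≐-s {a = a} {b} p =
  let x , x∉ = fresh a in
  ⊢-≡ (cong₂ (λ c d → s c ≐ s d) (subst-var x a) (subst-var x b))
    (≐-cong x (s (var x)) (x∉ ≤-refl) p)

≐-⊕ : T ∣ Γ ⊢ a ≐ a′ → T ∣ Γ ⊢ b ≐ b′ → T ∣ Γ ⊢ a ⊕ b ≐ a′ ⊕ b′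
≐-⊕ {a = a} {a′} {b} {b′} p q =
  let m , m∉ = fresh a
      n , n∉ = fresh b
      k , k∉ = fresh a′
      -- One argument is exchanged at a time: `x` is fresh for `a` and `b`, and `z` for `b` and
      -- `a′`.
      x = m + n ; z = n + k in ≐-trans
  (⊢-≡ (cong₂ _≐_
    (cong₂ _⊕_ (subst-var x a) (subst-absentᵗ b (n∉ (m≤n+m n m))))
    (cong₂ _⊕_ (subst-var x a′) (subst-absentᵗ b (n∉ (m≤n+m n m)))))
    (≐-cong x (var x ⊕ b) (m∉ (m≤m+n m n)) p))
  (⊢-≡ (cong₂ _≐_
    (cong₂ _⊕_ (subst-absentᵗ a′ (k∉ (m≤n+m k n))) (subst-var z b))
    (cong₂ _⊕_ (subst-absentᵗ a′ (k∉ (m≤n+m k n))) (subst-var z b′)))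
    (≐-cong z (a′ ⊕ var z) (n∉ (m≤m+n n k)) q))

≐-⊗ : T ∣ Γ ⊢ a ≐ a′ → T ∣ Γ ⊢ b ≐ b′ → T ∣ Γ ⊢ a ⊗ b ≐ a′ ⊗ b′
≐-⊗ {a = a} {a′} {b} {b′} p q =
  let m , m∉ = fresh a
      n , n∉ = fresh b
      k , k∉ = fresh a′
      x = m + n ; z = n + k in ≐-trans
  (⊢-≡ (cong₂ _≐_
    (cong₂ _⊗_ (subst-var x a) (subst-absentᵗ b (n∉ (m≤n+m n m))))
    (cong₂ _⊗_ (subst-var x a′) (subst-absentᵗ b (n∉ (m≤n+m n m)))))
    (≐-cong x (var x ⊗ b) (m∉ (m≤m+n m n)) p))
  (⊢-≡ (cong₂ _≐_
    (cong₂ _⊗_ (subst-absentᵗ a′ (k∉ (m≤n+m k n))) (subst-var z b))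
    (cong₂ _⊗_ (subst-absentᵗ a′ (k∉ (m≤n+m k n))) (subst-var z b′)))
    (≐-cong z (a′ ⊗ var z) (n∉ (m≤m+n n k)) q))

≼-resp : T ∣ Γ ⊢ a ≐ a′ → T ∣ Γ ⊢ b ≐ b′ → T ∣ Γ ⊢ a ≼ b → T ∣ Γ ⊢ a′ ≼ b′
≼-resp {a = a} {a′} {b} {b′} p q r =
  let n , n∉ = fresh b
      k , k∉ = fresh a′
  in
  =E-≡ (a′ ≼ var k) tt tt
    (cong₂ _≼_ (subst-absentᵗ a′ (k∉ ≤-refl)) (subst-var k b))
    (cong₂ _≼_ (subst-absentᵗ a′ (k∉ ≤-refl)) (subst-var k b′)) q
  (=E-≡ (var n ≼ b) tt tt
    (cong₂ _≼_ (subst-var n a) (subst-absentᵗ b (n∉ ≤-refl)))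
    (cong₂ _≼_ (subst-var n a′) (subst-absentᵗ b (n∉ ≤-refl))) p r)

≐-resp : T ∣ Γ ⊢ a ≐ a′ → T ∣ Γ ⊢ b ≐ b′ → T ∣ Γ ⊢ a ≐ b → T ∣ Γ ⊢ a′ ≐ b′
≐-resp p q r = ≐-trans (≐-sym p) (≐-trans r q)

-- Generalising over `x` and instantiating it to `a` turns the hypothesis into `a ≐ a`. Hypotheses
-- that give a variable a value are discharged in this way.
drop-definition : All (NotFree x) Γ → NotFree x C → NotIn x a →
                  T ∣ var x ≐ a ∷ Γ ⊢ C → T ∣ Γ ⊢ C
drop-definition {x} {Γ} {C} {a} x∉Γ x∉C x∉a p =
  ⇒E (⊢-≡
       (cong₂ _⇒_ (cong₂ _≐_ (subst-var x a) (subst-absentᵗ a x∉a)) (subst-absent C x∉C))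
       (∀E a (tt , FreeFor-absent C x∉C) (∀I x∉Γ (⇒I p))))
     (=I a)

module _ {y w : ℕ} (y≢w : y ≢ w) where
  open Renaming y w

  renᵗ-≐ : ∀ a → T ∣ Γ ⊢ var y ≐ var w → T ∣ Γ ⊢ a ≐ renᵗ a
  renᵗ-≐ (var x) e with x ≡ᵇ y | compare-≡ᵇ x y
  ... | _ | same refl = e
  ... | _ | diff _    = =I (var x)
  renᵗ-≐ 𝟎       e = =I 𝟎
  renᵗ-≐ (s a)   e = ≐-s (renᵗ-≐ a e)
  renᵗ-≐ (a ⊕ b) e = ≐-⊕ (renᵗ-≐ a e) (renᵗ-≐ b e)
  renᵗ-≐ (a ⊗ b) e = ≐-⊗ (renᵗ-≐ a e) (renᵗ-≐ b e)

  y∉w : NotIn y (var w)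
  y∉w = NotIn-var {y} {w} y≢w

  w∉y : NotIn w (var y)
  w∉y = NotIn-var {w} {y} (y≢w ∘ sym)

  NotFree-y-ren : ∀ A → NotFree y (ren A)
  NotFree-y-ren A = #⇒NotFree (ren A) (#-ren y≢w A)

  -- Both directions go by a joint induction, since `~` and `⇒` exchange them. A quantifier over
  -- another variable lets the equation pass inside. A quantifier over `y` rebinds `y`, so the outer
  -- equation says nothing about the body; a new equation is then assumed inside and removed by
  -- `drop-definition`.
  ren-⊢ : ∀ A → w # A → T ∣ Γ ⊢ var y ≐ var w → T ∣ Γ ⊢ A → T ∣ Γ ⊢ ren A
  ren-⊣ : ∀ A → w # A → T ∣ Γ ⊢ var y ≐ var w → T ∣ Γ ⊢ ren A → T ∣ Γ ⊢ A

  ren-⊢ (a ≐ b) f e p = ≐-resp (renᵗ-≐ a e) (renᵗ-≐ b e) p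
  ren-⊢ (a ≼ b) f e p = ≼-resp (renᵗ-≐ a e) (renᵗ-≐ b e) p
  ren-⊢ (~ A)   f e p = ¬I (ren-⊣ A (f ∘ there) (wk e) h₀) (wk p)
  ren-⊢ (A ∧ B) f e p = ∧I (ren-⊢ A (f ∘ ∈-infixˡ) e (∧E₁ p)) (ren-⊢ B (f ∘ ∈-infixʳ (symbols A)) e (∧E₂ p))
  ren-⊢ (A ∨ B) f e p = ∨E p (∨I₁ (ren-⊢ A (f ∘ ∈-infixˡ) (wk e) h₀))
                             (∨I₂ (ren-⊢ B (f ∘ ∈-infixʳ (symbols A)) (wk e) h₀))
  ren-⊢ (A ⇒ B) f e p = ⇒I (ren-⊢ B (f ∘ ∈-infixʳ (symbols A)) (wk e)
                             (⇒E (wk p) (ren-⊣ A (f ∘ ∈-infixˡ) (wk e) h₀)))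
  ren-⊢ (all x A) f e p with x ≡ᵇ y | compare-≡ᵇ x y
  ... | _ | same refl = cut₁ (∀I (#⇒NotFree (all y A) f ∷ [])
          (drop-definition (NotFree-all-≡ y A ∷ []) (NotFree-y-ren A) y∉w
            (ren-⊢ A (f ∘ there ∘ there ∘ there ∘ there) h₀ (∀E-self h₁)))) p
  ... | _ | diff x≢y = cut₂
          (∀I (+-zero⁺ (NotIn-var {x} {y} x≢y) (NotIn-var {x} {w} λ { refl → f (there (there (here refl))) })
               ∷ NotFree-all-≡ x A ∷ [])
            (ren-⊢ A (f ∘ there ∘ there ∘ there ∘ there) h₀ (∀E-self h₁))) e p
  ren-⊢ (ex x A) f e p with x ≡ᵇ y | compare-≡ᵇ x y
  ... | _ | same refl = cut₁ (∃E (NotFree-all-≡ y A ∷ []) (NotFree-all y w (ren A) (NotFree-y-ren A)) h₀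
          (drop-definition (#⇒NotFree A f′ ∷ #⇒NotFree (ex y A) f ∷ []) (NotFree-all-≡ w (ren A)) w∉y
            (∃I-self (ren-⊢ A f′ (≐-sym h₀) h₁)))) p
    where f′ = f ∘ there ∘ there ∘ there ∘ there
  ... | _ | diff x≢y = cut₂
          (∃E (+-zero⁺ (NotIn-var {x} {y} x≢y) (NotIn-var {x} {w} λ { refl → f (there (there (here refl))) })
               ∷ NotFree-all-≡ x A ∷ [])
            (NotFree-all-≡ x (ren A)) h₁
            (∃I-self (ren-⊢ A (f ∘ there ∘ there ∘ there ∘ there) h₁ h₀))) e p

  ren-⊣ (a ≐ b) f e p = ≐-resp (≐-sym (renᵗ-≐ a e)) (≐-sym (renᵗ-≐ b e)) p
  ren-⊣ (a ≼ b) f e p = ≼-resp (≐-sym (renᵗ-≐ a e)) (≐-sym (renᵗ-≐ b e)) p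
  ren-⊣ (~ A)   f e p = ¬I (ren-⊢ A (f ∘ there) (wk e) h₀) (wk p)
  ren-⊣ (A ∧ B) f e p = ∧I (ren-⊣ A (f ∘ ∈-infixˡ) e (∧E₁ p)) (ren-⊣ B (f ∘ ∈-infixʳ (symbols A)) e (∧E₂ p))
  ren-⊣ (A ∨ B) f e p = ∨E p (∨I₁ (ren-⊣ A (f ∘ ∈-infixˡ) (wk e) h₀))
                             (∨I₂ (ren-⊣ B (f ∘ ∈-infixʳ (symbols A)) (wk e) h₀))
  ren-⊣ (A ⇒ B) f e p = ⇒I (ren-⊣ B (f ∘ ∈-infixʳ (symbols A)) (wk e)
                             (⇒E (wk p) (ren-⊢ A (f ∘ ∈-infixˡ) (wk e) h₀)))
  ren-⊣ (all x A) f e p with x ≡ᵇ y | compare-≡ᵇ x y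
  ... | _ | same refl = cut₁ (∀I (NotFree-all y w (ren A) (NotFree-y-ren A) ∷ [])
          (drop-definition (NotFree-all-≡ w (ren A) ∷ []) (#⇒NotFree A f′) w∉y
            (ren-⊣ A f′ (≐-sym h₀) (∀E-self h₁)))) p
    where f′ = f ∘ there ∘ there ∘ there ∘ there
  ... | _ | diff x≢y = cut₂
          (∀I (+-zero⁺ (NotIn-var {x} {y} x≢y) (NotIn-var {x} {w} λ { refl → f (there (there (here refl))) })
               ∷ NotFree-all-≡ x (ren A) ∷ [])
            (ren-⊣ A (f ∘ there ∘ there ∘ there ∘ there) h₀ (∀E-self h₁))) e p
  ren-⊣ (ex x A) f e p with x ≡ᵇ y | compare-≡ᵇ x y
  ... | _ | same refl = cut₁ (∃E (NotFree-all-≡ w (ren A) ∷ []) (#⇒NotFree (ex y A) f) h₀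
          (drop-definition (NotFree-y-ren A ∷ NotFree-all y w (ren A) (NotFree-y-ren A) ∷ [])
            (NotFree-all-≡ y A) y∉w
            (∃I-self (ren-⊣ A (f ∘ there ∘ there ∘ there ∘ there) h₀ h₁)))) p
  ... | _ | diff x≢y = cut₂
          (∃E (+-zero⁺ (NotIn-var {x} {y} x≢y) (NotIn-var {x} {w} λ { refl → f (there (there (here refl))) })
               ∷ NotFree-all-≡ x (ren A) ∷ [])
            (NotFree-all-≡ x A) h₁
            (∃I-self (ren-⊣ A (f ∘ there ∘ there ∘ there ∘ there) h₁ h₀))) e p

  ren-⟺ : ∀ A → w # A → NotFree y A → T ⊢ A ⟺ ren A
  ren-⟺ A f p = drop-definition [] (+-zero⁺ (+-zero⁺ p q) (+-zero⁺ q p)) y∉w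
    (∧I (⇒I (ren-⊢ A f h₁ h₀)) (⇒I (ren-⊣ A f h₁ h₀)))
    where q = NotFree-y-ren A

⟺-trans : T ∣ Γ ⊢ A ⟺ B → T ∣ Γ ⊢ B ⟺ C → T ∣ Γ ⊢ A ⟺ C
⟺-trans p q = ∧I (⇒I (⇒E (wk (∧E₁ q)) (⇒E (wk (∧E₁ p)) h₀)))
                  (⇒I (⇒E (wk (∧E₂ p)) (⇒E (wk (∧E₂ q)) h₀)))

⟺-sym : T ∣ Γ ⊢ A ⟺ B → T ∣ Γ ⊢ B ⟺ A
⟺-sym p = ∧I (∧E₂ p) (∧E₁ p)

-- A formula shorter than m misses some variable below m, so its variables from
-- m onwards can be traded one at a time for unused ones below m.
name-with-low-variables : ∀ {i m} d μ → (∀ x → ′v x ∈ symbols μ → x < d + m) →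
  ∣ μ ∣ < m → Names T μ i →
  ∃[ ν ] (∀ x → ′v x ∈ symbols ν → x < m) × ∣ ν ∣ < m × Names T ν i
name-with-low-variables zero μ low short names = μ , low , short , names
name-with-low-variables {T} {i} {m} (suc d) μ low short (closed-but-0 , p) =
  let w , w<m , w#μ = fresh-variable μ short
      y = d + m
      w<y = <-≤-trans w<m (m≤n+m m d)
      y≢w = <⇒≢ w<y ∘ sym
      open Renaming y w
      -- `m` exceeds a length and so is positive. Hence the highest admissible variable `y` is not
      -- `v₀`, it is not free in `μ`, and renaming it preserves what `μ` names.
      y≢0 = <⇒≢ (<-≤-trans (<-≤-trans z<s short) (m≤n+m m d)) ∘ sym
      y∉μ = closed-but-0 y (λ { (here e) → y≢0 e })
  in name-with-low-variables d (ren μ)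
       (λ x x∈ → let z , z∈ , e = ′v∈ren⁻ μ x∈ in
         subst (_< y) (sym e) (lowered y w w<y z (low z z∈)))
       (subst (_< m) (sym (length-ren μ)) short)
       ( only-0 y w w#μ y∉μ y≢w
       , ∀I [] (⟺-trans (⟺-sym (ren-⟺ y≢w μ w#μ y∉μ)) (∀E-self p)))
  where
  lowered : ∀ y w → w < y → ∀ z → z < suc y → Renaming.renᵛ y w z < y
  lowered y w w<y z z<1+y with z ≡ᵇ y | compare-≡ᵇ z y
  ... | _ | same _   = w<y
  ... | _ | diff z≢y = ≤∧≢⇒< (s≤s⁻¹ z<1+y) z≢y
  only-0 : ∀ y w → w # μ → NotFree y μ → y ≢ w → FreeAmong (0 ∷ []) (Renaming.ren y w μ)
  only-0 y w w#μ y∉μ y≢w x x∉ with x ≟ y | x ≟ w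
  ... | yes refl | _ = NotFree-y-ren y≢w μ
  -- A free `w` in the renamed formula could only stem from a free `y` in `μ`.
  ... | no _ | yes refl = subst (λ u → NotFree u (Renaming.ren y w μ)) (Renaming.renᵛ-≡ y w {x = y} refl)
                            (Renaming.NotFree-ren y w μ y≢w w#μ y∉μ)
  ... | no x≢y | no x≢w = subst (λ u → NotFree u (Renaming.ren y w μ)) (Renaming.renᵛ-≢ y w x≢y)
                            (Renaming.NotFree-ren y w μ x≢w w#μ (closed-but-0 x x∉))

-- Arithmetic in Q

-- `~ 𝟎 ≐ 𝟎` serves as falsum: being free of variables, it can be the conclusion of any `∃E`.
refute : T ∣ A ∷ Γ ⊢ ~ 𝟎 ≐ 𝟎 → T ∣ Γ ⊢ ~ A
refute = ¬I (=I 𝟎)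

by-contradiction : T ∣ (~ A) ∷ Γ ⊢ A → T ∣ Γ ⊢ A
by-contradiction p = ¬¬E (¬I p h₀)

upTo : Term → ℕ → Formula
upTo a zero    = a ≐ 𝟎
upTo a (suc m) = upTo a m ∨ a ≐ numeral (suc m)

upTo-subst : ∀ m → upTo b m [ x := a ] ≡ upTo (b [ x := a ]ᵗ) m
upTo-subst zero    = refl
upTo-subst {b = b} {x = x} {a = a} (suc m) =
  cong₂ _∨_ (upTo-subst m) (cong (b [ x := a ]ᵗ ≐_) (subst-numeral (suc m)))

NotFree-upTo : ∀ a m → NotIn x a → NotFree x (upTo a m)
NotFree-upTo a zero    p = +-zero⁺ p refl
NotFree-upTo {x = x} a (suc m) p =
  +-zero⁺ (NotFree-upTo a m p) (+-zero⁺ p (numeral-closed (suc m) x))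

upTo-intro : l ≤ m → T ∣ Γ ⊢ a ≐ numeral l → T ∣ Γ ⊢ upTo a m
upTo-intro {m = zero} z≤n p = p
upTo-intro {m = suc m} l≤m p with m≤n⇒m<n∨m≡n l≤m
... | inj₁ l<m  = ∨I₁ (upTo-intro (s≤s⁻¹ l<m) p)
... | inj₂ refl = ∨I₂ p

upTo-elim : ∀ m → T ∣ Γ ⊢ upTo a m →
            (∀ l → l ≤ m → T ∣ a ≐ numeral l ∷ Γ ⊢ C) → T ∣ Γ ⊢ C
upTo-elim zero    p f = cut p (f 0 z≤n)
upTo-elim (suc m) p f = ∨E p
  (upTo-elim m h₀ (λ l l≤m → weak (λ { (here e) → here e ; (there q) → there (there q) })
                               (f l (m≤n⇒m≤1+n l≤m))))
  (f (suc m) ≤-refl)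

FreeFor-upTo : ∀ m → FreeFor a x (upTo b m)
FreeFor-upTo zero    = tt
FreeFor-upTo (suc m) = FreeFor-upTo m , tt

module Arithmetic {T : Theory} (ext : ExtendsQ T) where

  private
    axioms : ∀ {A} → A ∈ Q → T ∣ Γ ⊢ A
    axioms A∈Q = close (All.lookup ext A∈Q)

  s≢𝟎 : ∀ a → T ∣ Γ ⊢ ~ s a ≐ 𝟎
  s≢𝟎 a = ∀E a tt (axioms (here refl))

  -- The condition on `a` comes from the nested quantifiers of the axiom: `a` is inserted under the
  -- binder of `v₁`.
  s-injective : ∀ b → NotIn 1 a → T ∣ Γ ⊢ s a ≐ s b → T ∣ Γ ⊢ a ≐ b
  s-injective {a} b p = ⇒E (⊢-≡ (cong (λ c → s c ≐ s b ⇒ c ≐ b) (subst-absentᵗ a p))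
    (∀E b (tt , tt) (∀E a (inj₂ (p , tt , tt)) (axioms (there (here refl))))))

  v₀-cases : All (NotFree 3) Γ → NotFree 3 C →
             T ∣ var 0 ≐ 𝟎 ∷ Γ ⊢ C → T ∣ var 0 ≐ s (var 3) ∷ Γ ⊢ C → T ∣ Γ ⊢ C
  v₀-cases {Γ} {C} p q r t = by-contradiction
    (∃E (q ∷ p) q
      -- The axiom binds the predecessor by `v₁`; it is rebound by `v₃`, which stays clear of the
      -- `v₁` and `v₂` bound in the other axioms.
      (cut₁ (∃E (refl ∷ []) refl (⇒E (∀E-self (axioms (there (there (here refl))))) h₀) (∃I (var 1) tt h₀))
        (¬I (weak skip r) h₁))
      (weak skip t))
    where
    skip : ∀ {A B} → A ∷ Γ ⊆ A ∷ B ∷ Γ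
    skip (here e)  = here e
    skip (there k) = there (there k)

  ⊕-𝟎 : ∀ a → T ∣ Γ ⊢ a ⊕ 𝟎 ≐ a
  ⊕-𝟎 a = ∀E a tt (axioms (there (there (there (here refl)))))

  ⊕-s : ∀ b → NotIn 1 a → T ∣ Γ ⊢ a ⊕ s b ≐ s (a ⊕ b)
  ⊕-s {a} b p = ⊢-≡ (cong (λ c → c ⊕ s b ≐ s (c ⊕ b)) (subst-absentᵗ a p))
    (∀E b tt (∀E a (inj₂ (p , tt)) (axioms (there (there (there (there (here refl))))))))

  ⊗-𝟎 : ∀ a → T ∣ Γ ⊢ a ⊗ 𝟎 ≐ 𝟎
  ⊗-𝟎 a = ∀E a tt (axioms (there (there (there (there (there (here refl)))))))

  ⊗-s : ∀ b → NotIn 1 a → T ∣ Γ ⊢ a ⊗ s b ≐ a ⊗ b ⊕ a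
  ⊗-s {a} b p = ⊢-≡ (cong (λ c → c ⊗ s b ≐ c ⊗ b ⊕ c) (subst-absentᵗ a p))
    (∀E b tt (∀E a (inj₂ (p , tt))
      (axioms (there (there (there (there (there (there (here refl))))))))))

  ≼-⟺ : NotIn 1 a → NotIn 2 a → NotIn 2 b → T ∣ Γ ⊢ a ≼ b ⟺ ex 2 (var 2 ⊕ a ≐ b)
  ≼-⟺ {a} {b} p q r = ⊢-≡ (cong (λ c → c ≼ b ⟺ ex 2 (var 2 ⊕ c ≐ b)) (subst-absentᵗ a p))
    (∀E b ((tt , inj₂ (r , tt)) , (inj₂ (r , tt) , tt))
      (∀E a (inj₂ (p , (tt , inj₂ (q , tt)) , (inj₂ (q , tt) , tt)))
        (axioms (there (there (there (there (there (there (there (here refl)))))))))))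

  ≼-intro : NotIn 1 a → NotIn 2 a → NotIn 2 b → ∀ c → T ∣ Γ ⊢ c ⊕ a ≐ b → T ∣ Γ ⊢ a ≼ b
  ≼-intro {a} {b} p q r c d = ⇒E (∧E₂ (≼-⟺ p q r))
    (∃I c tt (⊢-≡ (sym (cong₂ (λ a b → c ⊕ a ≐ b) (subst-absentᵗ a q) (subst-absentᵗ b r))) d))

  num-⊕ : ∀ i j → T ∣ Γ ⊢ numeral i ⊕ numeral j ≐ numeral (i + j)
  num-⊕ i zero rewrite +-identityʳ i = ⊕-𝟎 (numeral i)
  num-⊕ i (suc j) rewrite +-suc i j =
    ≐-trans (⊕-s (numeral j) (numeral-closed i 1)) (≐-s (num-⊕ i j))

  num-⊗ : ∀ i j → T ∣ Γ ⊢ numeral i ⊗ numeral j ≐ numeral (i * j)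
  num-⊗ i zero rewrite *-zeroʳ i = ⊗-𝟎 (numeral i)
  num-⊗ i (suc j) rewrite *-suc i j | +-comm i (i * j) =
    ≐-trans (⊗-s (numeral j) (numeral-closed i 1))
      (≐-trans (≐-⊕ (num-⊗ i j) (=I (numeral i))) (num-⊕ (i * j) i))

  num-≢ : ∀ i j → i ≢ j → T ∣ Γ ⊢ ~ numeral i ≐ numeral j
  num-≢ zero    zero    i≢j = contradiction refl i≢j
  num-≢ zero    (suc j) i≢j = ¬I (≐-sym h₀) (s≢𝟎 (numeral j))
  num-≢ (suc i) zero    i≢j = s≢𝟎 (numeral i)
  num-≢ (suc i) (suc j) i≢j =
    ¬I (s-injective (numeral j) (numeral-closed i 1) h₀) (num-≢ i j (i≢j ∘ cong suc))

  num-≤ : i ≤ j → T ∣ Γ ⊢ numeral i ≼ numeral j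
  num-≤ {i} {j} i≤j = ≼-intro (numeral-closed i 1) (numeral-closed i 2) (numeral-closed j 2)
    (numeral (j ∸ i)) (subst (λ k → T ∣ _ ⊢ numeral (j ∸ i) ⊕ numeral i ≐ numeral k) (m∸n+n≡m i≤j) (num-⊕ (j ∸ i) i))

  ≼-elim : NotIn 1 a → NotIn 2 a → NotIn 2 b → All (NotFree 2) Γ → NotFree 2 C →
           T ∣ Γ ⊢ a ≼ b → T ∣ var 2 ⊕ a ≐ b ∷ Γ ⊢ C → T ∣ Γ ⊢ C
  ≼-elim p q r f g t = ∃E f g (⇒E (∧E₁ (≼-⟺ p q r)) t)

  private
    v₂-⊕-cong-s : ∀ b → T ∣ Γ ⊢ var 0 ≐ s b → T ∣ Γ ⊢ var 2 ⊕ var 0 ≐ s (var 2 ⊕ b)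
    v₂-⊕-cong-s b p = ≐-trans (≐-⊕ (=I (var 2)) p) (⊕-s b refl)

  -- `Q` has no induction schema, so the induction on `m` is carried out outside the theory. If `v₀`
  -- is the successor of `v₃` and `v₂ + v₀` is the successor of `m`, then `v₂ + v₃` is `m`, and the
  -- previous sentence is applied to `v₃`.
  v₀-upTo : ∀ m → T ⊢ all 0 (var 0 ≼ numeral m ⇒ upTo (var 0) m)
  v₀-upTo zero = ∀I [] (⇒I (≼-elim refl refl refl (refl ∷ []) refl h₀
    (v₀-cases (refl ∷ refl ∷ []) refl h₀
      (absurd (≐-trans (≐-sym (v₂-⊕-cong-s (var 3) h₀)) h₁) (s≢𝟎 (var 2 ⊕ var 3))))))
  v₀-upTo (suc m) = ∀I [] (⇒I (≼-elim refl refl (numeral-closed m 2)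
    (numeral-closed m 2 ∷ []) (NotFree-upTo (var 0) (suc m) refl) h₀
    (v₀-cases (numeral-closed m 3 ∷ numeral-closed m 3 ∷ []) (NotFree-upTo (var 0) (suc m) refl)
      (upTo-intro {m = suc m} z≤n h₀)
      (upTo-elim m
        (⇒E (⊢-≡ (cong₂ (λ c B → var 3 ≼ c ⇒ B) (subst-numeral m) (upTo-subst m))
              (∀E (var 3) (tt , FreeFor-upTo m) (close (v₀-upTo m))))
            (≼-intro refl refl (numeral-closed m 2) (var 2)
              (s-injective (numeral m) refl (≐-trans (≐-sym (v₂-⊕-cong-s (var 3) h₀)) h₁))))
        (λ l l≤m → upTo-intro {m = suc m} (s≤s l≤m) (≐-trans h₁ (≐-s h₀)))))))

  ≼-upTo : ∀ m → T ∣ Γ ⊢ a ≼ numeral m → T ∣ Γ ⊢ upTo a m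
  ≼-upTo {a = a} m = ⇒E (⊢-≡ (cong₂ (λ c B → a ≼ c ⇒ B) (subst-numeral m) (upTo-subst m))
    (∀E a (tt , FreeFor-upTo m) (close (v₀-upTo m))))

  -- Again an induction on the numeral outside the theory: `v₀` is zero or a successor, and in the
  -- latter case the comparison of its predecessor with `m` carries over.
  total : ∀ m → T ⊢ all 0 (var 0 ≼ numeral m ∨ numeral m ≼ var 0)
  total zero    = ∀I [] (∨I₂ (≼-intro refl refl refl (var 0) (⊕-𝟎 (var 0))))
  total (suc m) = ∀I [] (v₀-cases [] (+-zero⁺ (+-zero⁺ refl (numeral-closed m 3)) (+-zero⁺ (numeral-closed m 3) refl))
    (∨I₁ (≼-resp (≐-sym h₀) (=I (numeral (suc m))) (num-≤ z≤n)))
    (∨E (⊢-≡ (cong (λ c → var 3 ≼ c ∨ c ≼ var 3) (subst-numeral m))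
          (∀E (var 3) (tt , tt) (close (total m))))
      (≼-elim refl refl (numeral-closed m 2) (numeral-closed m 2 ∷ refl ∷ []) ∉C h₀
        (∨I₁ (≼-intro refl refl (numeral-closed m 2) (var 2)
          (≐-trans (v₂-⊕-cong-s (var 3) (hyp (there (there (here refl))))) (≐-s h₀)))))
      (≼-elim (numeral-closed m 1) (numeral-closed m 2) refl (+-zero⁺ (numeral-closed m 2) refl ∷ refl ∷ []) ∉C h₀
        (∨I₂ (≼-intro (numeral-closed m 1) (numeral-closed m 2) refl (var 2)
          (≐-trans (⊕-s (numeral m) refl) (≐-trans (≐-s h₀) (≐-sym (hyp (there (there (here refl))))))))))))
    where
    ∉C : NotFree 2 (var 0 ≼ numeral (suc m) ∨ numeral (suc m) ≼ var 0)
    ∉C = +-zero⁺ (+-zero⁺ refl (numeral-closed m 2)) (+-zero⁺ (numeral-closed m 2) refl)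

  num-≰ : ∀ i j → ¬ i ≤ j → T ∣ Γ ⊢ ~ numeral i ≼ numeral j
  num-≰ i j i≰j = refute (upTo-elim j (≼-upTo j h₀)
    (λ l l≤j → absurd h₀ (num-≢ i l λ { refl → i≰j l≤j })))

-- Deciding Δ₀ formulas

-- Variables get their values as hypotheses, which avoids simultaneous substitution.
values : Assignment → List ℕ → List Formula
values ρ = map λ x → var x ≐ numeral (ρ x)

infixl 6 _∖_

-- Under a quantifier over `x` the old value of `x` has to leave the context, or else `∀I` and `∃E`
-- would not apply.
_∖_ : List ℕ → ℕ → List ℕ
xs ∖ x = filter (λ y → ¬? (x ≟ y)) xs

values-∖-⊆ : ∀ ρ xs x → values ρ (xs ∖ x) ⊆ values ρ xs
values-∖-⊆ ρ xs x = map⁺ _ (filter-⊆ _ xs)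

NotFree-values-∖ : ∀ ρ xs x → All (NotFree x) (values ρ (xs ∖ x))
NotFree-values-∖ ρ xs x = All.map⁺ (All.map
  (λ {y} x≢y → +-zero⁺ (NotIn-var {x} {y} x≢y) (numeral-closed (ρ y) x)) (All.all-filter _ xs))

update-≡ : ∀ (ρ : Assignment) x m → (ρ [ x ↦ m ]) x ≡ m
update-≡ ρ x m rewrite ≡ᵇ-refl x = refl

update-≢ : ∀ (ρ : Assignment) → x ≢ y → (ρ [ x ↦ m ]) y ≡ ρ y
update-≢ ρ x≢y rewrite ≢⇒≡ᵇ-false x≢y = refl

values-update : ∀ ρ xs x m →
  values (ρ [ x ↦ m ]) (x ∷ xs ∖ x) ≡ var x ≐ numeral m ∷ values ρ (xs ∖ x)
values-update ρ xs x m = cong₂ _∷_ (cong (λ k → var x ≐ numeral k) (update-≡ ρ x m))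
  (map-cong-local (All.map (λ x≢y → cong (λ k → var _ ≐ numeral k) (update-≢ ρ x≢y)) (All.all-filter _ xs)))

FreeAmong-body : ∀ {xs} A → FreeAmong xs (all x A) → FreeAmong (x ∷ xs ∖ x) A
FreeAmong-body {x} A f y y∉ = NotFree-all⁻ A (λ y≡x → y∉ (here y≡x))
  (f y λ y∈xs → y∉ (there (∈-filter⁺ _ y∈xs λ x≡y → y∉ (here (sym x≡y)))))

⟦⟧-update : ∀ a → NotIn x a → ⟦ a ⟧ (ρ [ x ↦ m ]) ≡ ⟦ a ⟧ ρ
⟦⟧-update {x} (var y) p with x ≡ᵇ y
⟦⟧-update (var y) () | true
... | false = refl
⟦⟧-update 𝟎     p = refl
⟦⟧-update (s a) p = cong suc (⟦⟧-update a p)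
⟦⟧-update {x} (a ⊕ b) p =
  let q , r = +-zero⁻ (occurrences x a) p in cong₂ _+_ (⟦⟧-update a q) (⟦⟧-update b r)
⟦⟧-update {x} (a ⊗ b) p =
  let q , r = +-zero⁻ (occurrences x a) p in cong₂ _*_ (⟦⟧-update a q) (⟦⟧-update b r)

search : ∀ {P R : ℕ → Set} → (∀ j → P j ⊎ R j) → ∀ n → (∀ j → j ≤ n → P j) ⊎ ∃ R
search {P} d zero with d 0
... | inj₁ p = inj₁ λ { .0 z≤n → p }
... | inj₂ r = inj₂ (0 , r)
search {P} d (suc n) with search d n | d (suc n)
... | inj₂ r | _      = inj₂ r
... | inj₁ _ | inj₂ r = inj₂ (suc n , r)
... | inj₁ f | inj₁ p = inj₁ λ j j≤1+n → case-≤ j (m≤n⇒m<n∨m≡n j≤1+n)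
  where
  case-≤ : ∀ j → j < suc n ⊎ j ≡ suc n → P j
  case-≤ j (inj₁ j<1+n) = f j (s≤s⁻¹ j<1+n)
  case-≤ j (inj₂ refl)  = p

module Decision {T : Theory} (ext : ExtendsQ T) where
  open Arithmetic ext

  -- Truth is decided along with provability: the constructive reading of truth offers no excluded
  -- middle, and the truth of a compound formula is assembled from these decisions.
  Decided : Assignment → List Formula → Formula → Set
  Decided ρ Γ A = ((ω, ρ ⊨ A) × (T ∣ Γ ⊢ A)) ⊎ (¬ (ω, ρ ⊨ A) × (T ∣ Γ ⊢ ~ A))

  weak-Decided : ∀ {Δ} → Γ ⊆ Δ → Decided ρ Γ A → Decided ρ Δ A
  weak-Decided Γ⊆Δ (inj₁ (t , p)) = inj₁ (t , weak Γ⊆Δ p)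
  weak-Decided Γ⊆Δ (inj₂ (t , p)) = inj₂ (t , weak Γ⊆Δ p)

  value : ∀ a ρ xs → (∀ x → x ∉ xs → NotIn x a) → T ∣ values ρ xs ⊢ a ≐ numeral (⟦ a ⟧ ρ)
  value (var x) ρ xs f with x ∈? xs
  ... | yes x∈xs = hyp (∈-map⁺ (λ x → var x ≐ numeral (ρ x)) x∈xs)
  ... | no  x∉xs with x ≡ᵇ x | ≡ᵇ-refl x | f x x∉xs
  ...   | _ | refl | ()
  value 𝟎     ρ xs f = =I 𝟎
  value (s a) ρ xs f = ≐-s (value a ρ xs f)
  value (a ⊕ b) ρ xs f = ≐-trans
    (≐-⊕ (value a ρ xs λ x → proj₁ ∘ +-zero⁻ (occurrences x a) ∘ f x)
         (value b ρ xs λ x → proj₂ ∘ +-zero⁻ (occurrences x a) ∘ f x)) (num-⊕ (⟦ a ⟧ ρ) (⟦ b ⟧ ρ))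
  value (a ⊗ b) ρ xs f = ≐-trans
    (≐-⊗ (value a ρ xs λ x → proj₁ ∘ +-zero⁻ (occurrences x a) ∘ f x)
         (value b ρ xs λ x → proj₂ ∘ +-zero⁻ (occurrences x a) ∘ f x)) (num-⊗ (⟦ a ⟧ ρ) (⟦ b ⟧ ρ))

  decided-≐ : ∀ a b ρ xs → FreeAmong xs (a ≐ b) → Decided ρ (values ρ xs) (a ≐ b)
  decided-≐ a b ρ xs f
    with va ← value a ρ xs (λ x → proj₁ ∘ +-zero⁻ (occurrences x a) ∘ f x)
       | vb ← value b ρ xs (λ x → proj₂ ∘ +-zero⁻ (occurrences x a) ∘ f x)
       | ⟦ a ⟧ ρ ≟ ⟦ b ⟧ ρ
  ... | yes e = inj₁ (e , ≐-trans va (≐-sym (subst (λ k → T ∣ _ ⊢ b ≐ numeral k) (sym e) vb)))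
  ... | no ¬e = inj₂ (¬e , ¬I (≐-resp (wk va) (wk vb) h₀) (num-≢ _ _ ¬e))

  decided-≼ : ∀ a b ρ xs → FreeAmong xs (a ≼ b) → Decided ρ (values ρ xs) (a ≼ b)
  decided-≼ a b ρ xs f
    with va ← value a ρ xs (λ x → proj₁ ∘ +-zero⁻ (occurrences x a) ∘ f x)
       | vb ← value b ρ xs (λ x → proj₂ ∘ +-zero⁻ (occurrences x a) ∘ f x)
       | ⟦ a ⟧ ρ ≤? ⟦ b ⟧ ρ
  ... | yes e = inj₁ (e , ≼-resp (≐-sym va) (≐-sym vb) (num-≤ e))
  ... | no ¬e = inj₂ (¬e , ¬I (≼-resp (wk va) (wk vb) h₀) (num-≰ _ _ ¬e))

  decided-~ : Decided ρ Γ A → Decided ρ Γ (~ A)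
  decided-~ (inj₁ (t , p)) = inj₂ ((λ f → f t) , ¬I (wk p) h₀)
  decided-~ (inj₂ r)       = inj₁ r

  decided-∧ : Decided ρ Γ A → Decided ρ Γ B → Decided ρ Γ (A ∧ B)
  decided-∧ (inj₁ (t , p)) (inj₁ (u , q)) = inj₁ ((t , u) , ∧I p q)
  decided-∧ (inj₂ (f , p)) _              = inj₂ (f ∘ proj₁ , ¬I (∧E₁ h₀) (wk p))
  decided-∧ (inj₁ _)       (inj₂ (g , q)) = inj₂ (g ∘ proj₂ , ¬I (∧E₂ h₀) (wk q))

  decided-∨ : Decided ρ Γ A → Decided ρ Γ B → Decided ρ Γ (A ∨ B)
  decided-∨ (inj₁ (t , p)) _              = inj₁ (inj₁ t , ∨I₁ p)
  decided-∨ (inj₂ _)       (inj₁ (u , q)) = inj₁ (inj₂ u , ∨I₂ q)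
  decided-∨ (inj₂ (f , p)) (inj₂ (g , q)) =
    inj₂ ((λ { (inj₁ t) → f t ; (inj₂ u) → g u })
         , refute (∨E h₀ (absurd h₀ (wk (wk p))) (absurd h₀ (wk (wk q)))))

  decided-⇒ : Decided ρ Γ A → Decided ρ Γ B → Decided ρ Γ (A ⇒ B)
  decided-⇒ (inj₂ (f , p)) _              = inj₁ ((λ t → contradiction t f) , ⇒I (absurd h₀ (wk p)))
  decided-⇒ (inj₁ _)       (inj₁ (u , q)) = inj₁ ((λ _ → u) , ⇒I (wk q))
  decided-⇒ (inj₁ (t , p)) (inj₂ (g , q)) = inj₂ ((λ h → g (h t)) , ¬I (⇒E h₀ (wk p)) (wk q))

  module _ (x : ℕ) (ρ : Assignment) (xs : List ℕ) where

    private
      Γ′ = values ρ (xs ∖ x)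
      x∉Γ′ = NotFree-values-∖ ρ xs x

    -- What the guards `≼` and `≺` have in common: they bound `x` by `n` in ω and reduce it to
    -- finitely many cases in the theory.
    record Guard (G : Formula) (n : ℕ) : Set where
      field
        true⇒≤ : ∀ m → (ω, ρ [ x ↦ m ] ⊨ G) → m ≤ n
        ⊢upTo  : T ∣ G ∷ Γ′ ⊢ upTo (var x) n
    open Guard

    module _ {n} (guard : Guard G n) where

      decided-all : (∀ m → Decided (ρ [ x ↦ m ]) (var x ≐ numeral m ∷ Γ′) (G ⇒ A)) →
                    Decided ρ Γ′ (all x (G ⇒ A))
      decided-all {A} d with search d n
      ... | inj₁ f = inj₁
              ( (λ m t → proj₁ (f m (true⇒≤ guard m t)) t)
              , ∀I x∉Γ′ (⇒I (upTo-elim n (⊢upTo guard) λ l l≤n →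
                  ⇒E (weak (λ { (here e) → here e ; (there k) → there (there k) }) (proj₂ (f l l≤n))) h₁)))
      ... | inj₂ (m , ¬t , p) = inj₂
              ( (λ h → ¬t (h m))
              , drop-definition x∉Γ′ (NotFree-all-≡ x (G ⇒ A)) (numeral-closed m x)
                  (¬I (∀E-self h₀) (wk p)))

      decided-ex : (∀ m → Decided (ρ [ x ↦ m ]) (var x ≐ numeral m ∷ Γ′) (G ∧ A)) →
                   Decided ρ Γ′ (ex x (G ∧ A))
      -- After `swap`, the search collects refutations and yields a witness as its alternative.
      decided-ex {A} d with search (swap ∘ d) n
      ... | inj₂ (m , t , p) = inj₁
              ( (m , t)
              , drop-definition x∉Γ′ (NotFree-all-≡ x (G ∧ A)) (numeral-closed m x) (∃I-self p))
      ... | inj₁ f = inj₂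
              ( (λ { (m , t) → proj₁ (f m (true⇒≤ guard m (proj₁ t))) t })
              , refute (∃E (NotFree-all-≡ x (G ∧ A) ∷ x∉Γ′) refl h₀
                  (upTo-elim n (⇒E (weak (there ∘ there) (⇒I (⊢upTo guard))) (∧E₁ h₀)) λ l l≤n →
                    absurd h₁ (weak (λ { (here e) → here e ; (there k) → there (there (there k)) })
                                    (proj₂ (f l l≤n))))))

  guard-≼ : ∀ x a ρ xs → NotIn x a → (∀ y → y ∉ x ∷ xs ∖ x → NotIn y a) →
            Guard x ρ xs (var x ≼ a) (⟦ a ⟧ ρ)
  guard-≼ x a ρ xs x∉a f = record
    { true⇒≤ = λ m t → subst₂ _≤_ (update-≡ ρ x m) (⟦⟧-update a x∉a) t
    ; ⊢upTo  = ≼-upTo (⟦ a ⟧ ρ) (≼-resp (=I (var x)) (wk (value a ρ (xs ∖ x) f′)) h₀) }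
    where
    f′ : ∀ y → y ∉ xs ∖ x → NotIn y a
    f′ y y∉ with y ≟ x
    ... | yes refl = x∉a
    ... | no  y≢x  = f y λ { (here e) → y≢x e ; (there k) → y∉ k }

  guard-≺ : ∀ x a ρ xs → NotIn x a → (∀ y → y ∉ x ∷ xs ∖ x → NotIn y a) →
            Guard x ρ xs (var x ≺ a) (⟦ a ⟧ ρ)
  guard-≺ x a ρ xs x∉a f = record
    { true⇒≤ = λ m t → true⇒≤ m (proj₁ t)
    ; ⊢upTo  = cut (∧E₁ h₀) (weak (λ { (here e) → here e ; (there k) → there (there k) }) ⊢upTo) }
    where open Guard (guard-≼ x a ρ xs x∉a f)

  decided-≺ : ∀ a b ρ xs → FreeAmong xs (a ≺ b) → Decided ρ (values ρ xs) (a ≺ b)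
  decided-≺ a b ρ xs f = decided-∧
    (decided-≼ a b ρ xs λ x → proj₁ ∘ +-zero⁻ (occurrences x a + occurrences x b) ∘ f x)
    (decided-~ (decided-≐ a b ρ xs λ x → proj₂ ∘ +-zero⁻ (occurrences x a + occurrences x b) ∘ f x))

  decide : Δ₀ A → ∀ ρ xs → FreeAmong xs A → Decided ρ (values ρ xs) A
  decide (eq {a} {b}) = decided-≐ a b
  decide (le {a} {b}) = decided-≼ a b
  decide (neg d) ρ xs f = decided-~ (decide d ρ xs f)
  decide (and {A} d e) ρ xs f = decided-∧
    (decide d ρ xs λ x → proj₁ ∘ +-zero⁻ (freeOccurrences x A) ∘ f x)
    (decide e ρ xs λ x → proj₂ ∘ +-zero⁻ (freeOccurrences x A) ∘ f x)
  decide (or {A} d e) ρ xs f = decided-∨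
    (decide d ρ xs λ x → proj₁ ∘ +-zero⁻ (freeOccurrences x A) ∘ f x)
    (decide e ρ xs λ x → proj₂ ∘ +-zero⁻ (freeOccurrences x A) ∘ f x)
  decide (imp {A} d e) ρ xs f = decided-⇒
    (decide d ρ xs λ x → proj₁ ∘ +-zero⁻ (freeOccurrences x A) ∘ f x)
    (decide e ρ xs λ x → proj₂ ∘ +-zero⁻ (freeOccurrences x A) ∘ f x)
  decide (all≤ {x} {a} {A} x∉a d) ρ xs f =
    weak-Decided (values-∖-⊆ ρ xs x) (decided-all x ρ xs (guard-≼ x a ρ xs x∉a a-among) λ m →
      subst (λ Γ → Decided (ρ [ x ↦ m ]) Γ (var x ≼ a ⇒ A)) (values-update ρ xs x m)
        (decided-⇒ (decided-≼ (var x) a _ _ G-among)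
                   (decide d _ _ λ y → proj₂ ∘ +-zero⁻ (freeOccurrences y (var x ≼ a)) ∘ body y)))
    where
    body = FreeAmong-body (var x ≼ a ⇒ A) f
    G-among = λ y → proj₁ ∘ +-zero⁻ (freeOccurrences y (var x ≼ a)) ∘ body y
    a-among = λ y → proj₂ ∘ +-zero⁻ (occurrences y (var x)) ∘ G-among y
  decide (all< {x} {a} {A} x∉a d) ρ xs f =
    weak-Decided (values-∖-⊆ ρ xs x) (decided-all x ρ xs (guard-≺ x a ρ xs x∉a a-among) λ m →
      subst (λ Γ → Decided (ρ [ x ↦ m ]) Γ (var x ≺ a ⇒ A)) (values-update ρ xs x m)
        (decided-⇒ (decided-≺ (var x) a _ _ G-among)
                   (decide d _ _ λ y → proj₂ ∘ +-zero⁻ (freeOccurrences y (var x ≺ a)) ∘ body y)))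
    where
    body = FreeAmong-body (var x ≺ a ⇒ A) f
    G-among = λ y → proj₁ ∘ +-zero⁻ (freeOccurrences y (var x ≺ a)) ∘ body y
    a-among = λ y → proj₂ ∘ +-zero⁻ (occurrences y (var x)) ∘ proj₁ ∘ +-zero⁻ (freeOccurrences y (var x ≼ a)) ∘ G-among y
  decide (ex≤ {x} {a} {A} x∉a d) ρ xs f =
    weak-Decided (values-∖-⊆ ρ xs x) (decided-ex x ρ xs (guard-≼ x a ρ xs x∉a a-among) λ m →
      subst (λ Γ → Decided (ρ [ x ↦ m ]) Γ (var x ≼ a ∧ A)) (values-update ρ xs x m)
        (decided-∧ (decided-≼ (var x) a _ _ G-among)
                   (decide d _ _ λ y → proj₂ ∘ +-zero⁻ (freeOccurrences y (var x ≼ a)) ∘ body y)))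
    where
    body = FreeAmong-body (var x ≼ a ∧ A) f
    G-among = λ y → proj₁ ∘ +-zero⁻ (freeOccurrences y (var x ≼ a)) ∘ body y
    a-among = λ y → proj₂ ∘ +-zero⁻ (occurrences y (var x)) ∘ G-among y
  decide (ex< {x} {a} {A} x∉a d) ρ xs f =
    weak-Decided (values-∖-⊆ ρ xs x) (decided-ex x ρ xs (guard-≺ x a ρ xs x∉a a-among) λ m →
      subst (λ Γ → Decided (ρ [ x ↦ m ]) Γ (var x ≺ a ∧ A)) (values-update ρ xs x m)
        (decided-∧ (decided-≺ (var x) a _ _ G-among)
                   (decide d _ _ λ y → proj₂ ∘ +-zero⁻ (freeOccurrences y (var x ≺ a)) ∘ body y)))
    where
    body = FreeAmong-body (var x ≺ a ∧ A) f
    G-among = λ y → proj₁ ∘ +-zero⁻ (freeOccurrences y (var x ≺ a)) ∘ body y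
    a-among = λ y → proj₂ ∘ +-zero⁻ (occurrences y (var x)) ∘ proj₁ ∘ +-zero⁻ (freeOccurrences y (var x ≼ a)) ∘ G-among y

-- Short names and ω-consistency

variables-bounded : (cs : List Symbol) → ∃[ d ] (∀ x → ′v x ∈ cs → x < d)
variables-bounded [] = 0 , λ _ ()
variables-bounded (c ∷ cs) =
  let d , f = variables-bounded cs
  -- The code of a variable exceeds its index by 14, so it bounds the index.
  in suc (symbolCode c) + d , λ
     { x (here refl) → s≤s (≤-trans (m≤n+m x 14) (m≤m+n (14 + x) d))
     ; x (there x∈)  → <-≤-trans (f x x∈) (m≤n+m d _) }

nameable⇒𝓑 : ∀ {g i j} → BoundsGödelNumbers g → NameableBelow T j i → 𝓑 T g i j
nameable⇒𝓑 {j = j} bounds (μ , short , names) =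
  let d , f = variables-bounded (symbols μ)
      ν , low , short′ , names′ =
        name-with-low-variables d μ (λ x x∈ → <-≤-trans (f x x∈) (m≤m+n d j)) short names
  in ν , bounds ν j low short′ , short′ , names′

𝓑⇒nameable : ∀ {g i j} → 𝓑 T g i j → NameableBelow T j i
𝓑⇒nameable (μ , _ , short , names) = μ , short , names

-- A finite number of double negations can be moved in front of the quantifier, one value at a time.
¬¬-bounded : ∀ {P : ℕ → Set} n → (∀ m → m < n → ¬ ¬ P m) → ¬ ¬ (∀ m → m < n → P m)
¬¬-bounded zero    f k = k λ m ()
¬¬-bounded {P} (suc n) f k =
  f n ≤-refl λ pₙ → ¬¬-bounded n (λ m m<n → f m (m≤n⇒m≤1+n m<n)) λ p →
  k λ m m<1+n → extended pₙ p (m≤n⇒m<n∨m≡n (s≤s⁻¹ m<1+n))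
  where
  extended : P n → (∀ m → m < n → P m) → m < n ⊎ m ≡ n → P m
  extended pₙ p (inj₁ m<n)  = p _ m<n
  extended pₙ p (inj₂ refl) = pₙ

at : ℕ → ℕ → Assignment
at i j 0             = i
at i j 1             = j
at i j (suc (suc _)) = 0

-- The two values become premises of a universally closed implication, which is instantiated at `a`
-- and `t`. So `a` need only be provably equal to `numeral i`: besides numerals, the variables `v₀`
-- and `v₂` are put for it.
instantiate : ∀ {t} → Closed t → ∀ B → FreeFor a 0 B → NotIn 1 a →
              T ∣ values (at i j) (0 ∷ 1 ∷ []) ⊢ B →
              T ∣ Γ ⊢ a ≐ numeral i → T ∣ Γ ⊢ t ≐ numeral j → T ∣ Γ ⊢ B [ 0 := a ] [ 1 := t ]
instantiate {a = a} {i = i} {j = j} {t = t} clt B ff 1∉a p q r =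
  ⇒E (⇒E (⊢-≡ unfold
    (∀E t (tt , (tt , FreeFor-closed clt 1 (B [ 0 := a ])))
      (∀E a (inj₂ (1∉a , (tt , (tt , ff)))) (close (∀I [] (∀I [] (⇒I (⇒I p)))))))) r) q
  where
  fix : ∀ k → numeral k [ 0 := a ]ᵗ [ 1 := t ]ᵗ ≡ numeral k
  fix k = trans (cong (_[ 1 := t ]ᵗ) (subst-numeral k)) (subst-numeral k)
  unfold : (var 1 ≐ numeral j ⇒ var 0 ≐ numeral i ⇒ B) [ 0 := a ] [ 1 := t ] ≡
       (t ≐ numeral j ⇒ a ≐ numeral i ⇒ B [ 0 := a ] [ 1 := t ])
  unfold rewrite fix i | fix j | subst-absentᵗ {1} {t} a 1∉a = refl

-- The quantified `x` may be `y` itself, and then the substitution stops at the quantifier. In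
-- either case the existential formula and the refutations of its instances keep a common matrix.
matrix-subst : ∀ y a x A → ∃[ A′ ] (ex x A [ y := a ] ≡ ex x A′) ×
  (∀ j → all x (var x ≐ numeral j ⇒ ~ A) [ y := a ] ≡ all x (var x ≐ numeral j ⇒ ~ A′))
matrix-subst y a x A with y ≡ᵇ x
... | true  = A , refl , λ _ → refl
... | false = A [ y := a ] , refl , λ j →
  cong (λ c → all x (var x ≐ c ⇒ ~ A [ y := a ])) (subst-numeral j)

-- The length of `ψ(v₀,t)`

tₖ-closed : ∀ k → Closed (tₖ k)
tₖ-closed k x = +-zero⁺ (numeral-closed 10 x) (+-zero⁺ (numeral-closed k x) (numeral-closed k x))

length-numeral : ∀ i → ∣ numeral i ∣ᵗ ≡ suc i
length-numeral zero    = refl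
length-numeral (suc i) = cong suc (length-numeral i)

-- Eleven symbols for the numeral of 10, `k + 1` for each numeral of `k`, three for each product.
-- The successor stands for the symbol given up at each replacement, leaving a net cost of
-- `2 * k + 18`.
length-tₖ : ∀ k → ∣ tₖ k ∣ᵗ ≡ suc (2 * k + 18)
length-tₖ k
  rewrite length-++ (symbolsᵗ (numeral k) ++ ′· ∷ symbolsᵗ (numeral k) ++ [ ′⟩ ]) {[ ′⟩ ]}
        | length-infix (symbolsᵗ (numeral k)) (symbolsᵗ (numeral k)) ′· ′⟩
        | length-numeral k =
  solve 1 (λ k → con 14 :+ (con 2 :+ ((con 1 :+ k) :+ (con 1 :+ k)) :+ con 1) := con 1 :+ (con 2 :* k :+ con 18)) refl k
  where open +-*-Solver

-- Two parentheses, the conjunction sign and the negation sign already make four, enough to give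
-- `4c≤k` below.
length-Ψ : ∀ φ → 4 ≤ ∣ Ψ φ ∣
length-Ψ φ = s≤s (subst (3 ≤_)
  (sym (length-infix (symbols (~ φ)) (symbols (all 2 (var 2 ≺ var 0 ⇒ φ [ 0 := var 2 ]))) ′∧ ′⟩))
  (s≤s (s≤s (s≤s z≤n))))

-- With `c` lowered by one, the length is at most `k + 2ck + 18c`. Its three summands are bounded by
-- one, two and five times `k²`; the five comes from `18c ≤ 20(c + 1) ≤ 5k`.
short-enough : ∀ {L L′ o c} → 4 ≤ L → o < c → let k = L * c in
               Replaced (suc (2 * k + 18)) o L L′ → L′ < 10 * (k * k)
short-enough {L} {L′} {o} {suc c} 4≤L (s≤s o≤c) (replaced p) = begin-strict
  L′                          ≡⟨ +-cancelʳ-≡ o L′ (L + o * (2 * k + 18)) (trans p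
                                  (solve 3 (λ l o q → l :+ o :* (con 1 :+ q) := l :+ o :* q :+ o) refl L o (2 * k + 18))) ⟩
  L + o * (2 * k + 18)        ≤⟨ +-mono-≤ L≤k (*-monoˡ-≤ (2 * k + 18) o≤c) ⟩
  k + c * (2 * k + 18)        ≡⟨ solve 2 (λ k c → k :+ c :* (con 2 :* k :+ con 18) := k :+ (con 2 :* (c :* k) :+ con 18 :* c)) refl k c ⟩
  k + (2 * (c * k) + 18 * c)  ≤⟨ +-mono-≤ k≤k² (+-mono-≤ (*-monoʳ-≤ 2 (*-monoˡ-≤ k c≤k)) (≤-trans 18c≤5k (*-monoʳ-≤ 5 k≤k²))) ⟩
  k² + (2 * k² + 5 * k²)      ≡⟨ solve 1 (λ q → q :+ (con 2 :* q :+ con 5 :* q) := con 8 :* q) refl k² ⟩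
  8 * k²                      <⟨ *-monoˡ-< k² {{>-nonZero 0<k²}} (s≤s (m≤n+m 8 1)) ⟩
  10 * k²                     ∎
  where
  open ≤-Reasoning
  open +-*-Solver
  k = L * suc c
  k² = k * k
  4c≤k : 4 * suc c ≤ k
  4c≤k = *-monoˡ-≤ (suc c) 4≤L
  c≤k : c ≤ k
  c≤k = ≤-trans (n≤1+n c) (≤-trans (m≤m+n (suc c) _) 4c≤k)
  L≤k : L ≤ k
  L≤k = m≤m*n L (suc c)
  0<k : 0 < k
  0<k = ≤-trans (≤-trans z<s 4≤L) L≤k
  k≤k² : k ≤ k²
  k≤k² = m≤m*n k k {{>-nonZero 0<k}}
  0<k² : 0 < k²
  0<k² = ≤-trans 0<k k≤k²
  18c≤5k : 18 * c ≤ 5 * k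
  18c≤5k = ≤-trans (*-mono-≤ (m≤n+m 18 2) (n≤1+n c))
    (≤-trans (≤-reflexive (*-assoc 5 4 (suc c))) (*-monoʳ-≤ 5 4c≤k))

-- Provable truths, refutable instances and the name of `n`

module _ {T : Theory} (ext : ExtendsQ T) where
  open Arithmetic ext
  open Decision ext

  tₖ-value : ∀ k → T ∣ Γ ⊢ tₖ k ≐ numeral (10 * (k * k))
  tₖ-value k = ≐-trans (≐-⊗ (=I (numeral 10)) (num-⊗ k k)) (num-⊗ 10 (k * k))

  -- The witness gives `x` a value under which the matrix is decided; its truth rules out the
  -- refutation.
  Σ₁-complete : ∀ {x xs} → Δ₀ A → ∀ ρ → FreeAmong xs (ex x A) →
                (ω, ρ ⊨ ex x A) → T ∣ values ρ xs ⊢ ex x A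
  Σ₁-complete {A} {x} {xs} d ρ f (m , holds) with decide d (ρ [ x ↦ m ]) (x ∷ xs ∖ x) (FreeAmong-body A f)
  ... | inj₂ (fails , _) = contradiction holds fails
  ... | inj₁ (_ , p) = weak (values-∖-⊆ ρ xs x)
    (drop-definition (NotFree-values-∖ ρ xs x) (NotFree-all-≡ x A) (numeral-closed m x)
      (∃I-self (subst (λ Γ → T ∣ Γ ⊢ A) (values-update ρ xs x m) p)))

  -- Without a witness the matrix is false at every `j`, hence refuted there. The instance stays an
  -- implication from `x ≐ numeral j`, the form in which `decide` supplies values.
  refutes-instances : ∀ {x xs} → Δ₀ A → ∀ ρ → FreeAmong xs (ex x A) → ¬ (ω, ρ ⊨ ex x A) →
                      ∀ j → T ∣ values ρ xs ⊢ all x (var x ≐ numeral j ⇒ ~ A)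
  refutes-instances {A} {x} {xs} d ρ f fails j with decide d (ρ [ x ↦ j ]) (x ∷ xs ∖ x) (FreeAmong-body A f)
  ... | inj₁ (holds , _) = contradiction (j , holds) fails
  ... | inj₂ (_ , p) = weak (values-∖-⊆ ρ xs x)
    (∀I (NotFree-values-∖ ρ xs x) (⇒I (subst (λ Γ → T ∣ Γ ⊢ ~ A) (values-update ρ xs x j) p)))

  ω-unprovable : ∀ {i j t} → Σ₁ A → FreeAmong (0 ∷ 1 ∷ []) A → Closed t → T ⊢ t ≐ numeral j →
                 ¬ (ω, at i j ⊨ A) → ω-Consistent T → T ⊬ A [ 0 := numeral i ] [ 1 := t ]
  ω-unprovable {i = i} {j = j} {t = t} (ex {A} x d) f clt t≐j fails ω-con p =
    let A₁ , ex₁ , all₁ = matrix-subst 0 (numeral i) x A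
        A₂ , ex₂ , all₂ = matrix-subst 1 t x A₁
        ex≡ = trans (cong (_[ 1 := t ]) ex₁) ex₂
        m , unrefuted = ω-con x A₂ (among A₂ ex≡) (⊢-≡ ex≡ p)
        q = instantiate {a = numeral i} clt (all x (var x ≐ numeral m ⇒ ~ A))
              (FreeFor-closed (numeral-closed i) 0 (all x (var x ≐ numeral m ⇒ ~ A))) (numeral-closed i 1)
              (refutes-instances d (at i j) f fails m) (=I (numeral i)) t≐j
        r = ⊢-≡ (trans (cong (_[ 1 := t ]) (all₁ m)) (all₂ m)) q
    in unrefuted (⇒E (⊢-≡ (cong₂ (λ c d → c ≐ d ⇒ ~ A₂ [ x := numeral m ])
                              (subst-var x (numeral m)) (subst-numeral m))
                       (∀E (numeral m) (tt , FreeFor-closed (numeral-closed m) x A₂) r))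
                     (=I (numeral m)))
    where
    sentence : ∀ y → NotFree y (ex x A [ 0 := numeral i ] [ 1 := t ])
    sentence y with y ≟ 1 | y ≟ 0
    ... | yes y≡1 | _ = NotFree-subst {y} {t} (ex x A [ 0 := numeral i ]) (clt y) (inj₁ y≡1)
    ... | no _ | yes y≡0 = NotFree-subst {y} {t} (ex x A [ 0 := numeral i ]) (clt y)
            (inj₂ (NotFree-subst {y} {numeral i} {0} (ex x A) (numeral-closed i y) (inj₁ y≡0)))
    ... | no y≢1 | no y≢0 = NotFree-subst {y} {t} (ex x A [ 0 := numeral i ]) (clt y)
            (inj₂ (NotFree-subst {y} {numeral i} {0} (ex x A) (numeral-closed i y)
              (inj₂ (f y λ { (here e) → y≢0 e ; (there (here e)) → y≢1 e }))))
    among : ∀ A₂ → ex x A [ 0 := numeral i ] [ 1 := t ] ≡ ex x A₂ → FreeAmong (x ∷ []) A₂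
    among A₂ e y y∉ = NotFree-all⁻ A₂ (λ y≡x → y∉ (here y≡x)) (subst (NotFree y) e (sentence y))

  module _ {φ t j} (free : FreeAmong (0 ∷ 1 ∷ []) φ) (v₂-free : FreeFor (var 2) 0 φ)
           (clt : Closed t) (t≐j : T ⊢ t ≐ numeral j) where

    FreeAmong-Ψ : FreeAmong (0 ∷ []) (Ψ φ [ 1 := t ])
    FreeAmong-Ψ x x∉ with x ≟ 1
    ... | yes x≡1 = NotFree-subst {x} {t} (Ψ φ) (clt x) (inj₁ x≡1)
    ... | no x≢1 = NotFree-subst {x} {t} (Ψ φ) (clt x) (inj₂ (+-zero⁺ x∉φ (body x x∉ x≢1 x∉φ)))
      where
      x∉φ = free x λ { (here e) → x∉ (here e) ; (there (here e)) → x≢1 e }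
      body : ∀ x → x ∉ 0 ∷ [] → x ≢ 1 → NotFree x φ →
             NotFree x (all 2 (var 2 ≺ var 0 ⇒ φ [ 0 := var 2 ]))
      body 0 x∉ _ _ = contradiction (here refl) x∉
      body 1 _ x≢1 _ = contradiction refl x≢1
      body 2 _ _ _ = refl
      body (suc (suc (suc x))) _ _ p = NotFree-subst {3 + x} {var 2} φ refl (inj₂ p)

    -- If `v₀` satisfies `ψ`, it is not below `n`, where `φ` is provable, and not above, since then
    -- `φ` would hold at `n`. Conversely, whatever lies strictly below `n` is one of finitely many
    -- numerals, all covered by `below`.
    Ψ-names : ∀ n → (∀ m → m < n → T ∣ values (at m j) (0 ∷ 1 ∷ []) ⊢ φ) →
              T ⊢ ~ φ [ 0 := numeral n ] [ 1 := t ] → Names T (Ψ φ [ 1 := t ]) n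
    Ψ-names n below p = FreeAmong-Ψ , ∀I [] (∧I (⇒I to) (⇒I from))
      where
      φ-at : ∀ {m} → m < n → T ∣ Γ ⊢ var 0 ≐ numeral m → T ∣ Γ ⊢ φ [ 1 := t ]
      φ-at m<n q = ⊢-≡ (cong (_[ 1 := t ]) (subst-id 0 φ))
        (instantiate clt φ (FreeFor-self 0 φ) refl (below _ m<n) q (close t≐j))

      -- `v₂` is not free in `φ`, so the detour through it amounts to a direct substitution of `n`.
      at-n : φ [ 0 := var 2 ] [ 1 := t ] [ 2 := numeral n ] ≡ φ [ 0 := numeral n ] [ 1 := t ]
      at-n = trans (subst-comm (λ ()) clt (numeral-closed n) (φ [ 0 := var 2 ]))
        (cong (_[ 1 := t ]) (subst-trans φ v₂-free (free 2 λ { (here ()) ; (there (here ())) ; (there (there ())) })))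

      to : T ∣ Ψ φ [ 1 := t ] ∷ [] ⊢ var 0 ≐ numeral n
      to = ∨E (∀E-self (close (total n)))
        (upTo-elim n (≼-upTo n h₀) λ l l≤n → lower (m≤n⇒m<n∨m≡n l≤n))
        -- From `n ≼ v₀` and `v₀ ≠ n` follows `n ≺ v₀`, so the second conjunct of `ψ` at `n` yields
        -- the refuted `φ(n,t)`.
        (by-contradiction (absurd
          (⊢-≡ at-n (⇒E (∀E (numeral n) (FreeFor-closed (numeral-closed n) 2 (var 2 ≺ var 0 ⇒ φ [ 0 := var 2 ] [ 1 := t ]))
                          (∧E₂ (hyp (there (there (here refl))))))
                        (∧I h₁ (¬I (≐-sym h₀) h₁))))
          (close p)))
        where
        lower : ∀ {l} → l < n ⊎ l ≡ n → T ∣ var 0 ≐ numeral l ∷ var 0 ≼ numeral n ∷ Ψ φ [ 1 := t ] ∷ [] ⊢ var 0 ≐ numeral n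
        lower (inj₁ l<n)  = absurd (φ-at l<n h₀) (∧E₁ (hyp (there (there (here refl)))))
        lower (inj₂ refl) = h₀

      from : T ∣ var 0 ≐ numeral n ∷ [] ⊢ Ψ φ [ 1 := t ]
      from = ∧I
        (=E-≡ (~ φ [ 1 := t ]) (FreeFor-closed (numeral-closed n) 0 (φ [ 1 := t ])) (FreeFor-self 0 (φ [ 1 := t ]))
          (cong ~_ (sym (subst-comm (λ ()) (numeral-closed n) clt φ))) (cong ~_ (subst-id 0 (φ [ 1 := t ])))
          (≐-sym h₀) (close p))
        (∀I (numeral-closed n 2 ∷ []) (⇒I
          (upTo-elim n (≼-upTo n (≼-resp (=I (var 2)) h₁ (∧E₁ h₀))) λ l l≤n → lower (m≤n⇒m<n∨m≡n l≤n))))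
        where
        lower : ∀ {l} → l < n ⊎ l ≡ n → T ∣ var 2 ≐ numeral l ∷ var 2 ≺ var 0 ∷ var 0 ≐ numeral n ∷ [] ⊢ φ [ 0 := var 2 ] [ 1 := t ]
        lower (inj₁ l<n)  = instantiate clt φ v₂-free refl (below _ l<n) h₀ (close t≐j)
        lower (inj₂ refl) = absurd (≐-trans h₀ (≐-sym (hyp (there (there (here refl)))))) (∧E₂ h₁)

corollary3 : (T : Theory) → RecursivelyAxiomatizable T → ExtendsQ T →
    (g : ℕ → ℕ) → Recursive g → BoundsGödelNumbers g →
    (φ : Formula) → Σ₁ φ → FreeAmong (0 ∷ 1 ∷ []) φ →
    FreeFor (var 2) 0 φ → Defines φ (𝓑 T g) →
    (k₂ : ℕ) → freeOccurrences 1 (Ψ φ) < k₂ →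
    let k = ∣ Ψ φ ∣ * k₂
        t = tₖ k
        𝐭 = 10 * (k * k)
    in
    (n : ℕ) → Least (λ i → ¬ NameableBelow T 𝐭 i) n →
    let φ⟨n,t⟩ = φ [ 0 := numeral n ] [ 1 := t ]
    in (Consistent T → (T ⊬ ~ φ⟨n,t⟩)) × (ω-Consistent T → (T ⊬ φ⟨n,t⟩))
corollary3 T _ ext g _ bounds φ@(ex x A) Σφ@(ex x d) free v₂-free defines k₂ occ<k₂ n (unnameable , least) =
    -- Leastness only says that a number below `n` cannot fail to be nameable. The goal is a
    -- contradiction, so these double negations may be removed together.
    (λ _ p → ¬¬-bounded n (λ m m<n ¬nameable → <⇒≱ m<n (least m ¬nameable)) λ nameable →
      unnameable
        ( Ψ φ [ 1 := t ]
        , short-enough (length-Ψ φ) occ<k₂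
            (subst (λ l → Replaced l (freeOccurrences 1 (Ψ φ)) ∣ Ψ φ ∣ ∣ Ψ φ [ 1 := t ] ∣) (length-tₖ k) (length-subst {1} {t} (Ψ φ)))
        , Ψ-names ext free v₂-free (tₖ-closed k) (tₖ-value ext k) n
            (λ m m<n → Σ₁-complete ext d (at m 𝐭) free
              (to (defines (at m 𝐭)) (nameable⇒𝓑 bounds (nameable m m<n)))) p))
  , ω-unprovable ext Σφ free (tₖ-closed k) (tₖ-value ext k)
      -- If `φ(n,t)` were true, `n` would be related to 𝐭 by `𝓑` and so have a short name.
      (λ holds → unnameable (𝓑⇒nameable {g = g} (from (defines (at n 𝐭)) holds)))
  where
  open Equivalence
  k = ∣ Ψ φ ∣ * k₂
  t = tₖ k
  𝐭 = 10 * (k * k)
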